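{- Let $\mathcal{W}=\{S_{\infty},T_{2}\}\cup\{C_{n}\mid n\ge2\}\cup\{Z_{n}\mid n\ge2\}$. A team of polyominoes containing fewer than $5$ polyominoes is a winner if and only if it is simpler than $\mathcal{W}$. That is, such a team $\mathcal{F}$ is a winner if and only if $\mathcal{F}\preceq\mathcal{W}$.
   Context: Board and polyominoes. The cells are the translates of the unit square $[0,1]\times[0,1]$ by vectors of $\mathbf{Z}^2$; identify a cell with the vector in $\mathbf{Z}^2$. Two cells are adjacent if they share an edge. A polyomino is a nonempty (finite or infinite) set of cells that is connected through adjacent cells, considered up to congruence (translations, rotations, reflections of the board). Game. Two players, maker (moving first) and breaker, alternately mark previously unmarked cells of the infinite board: in each turn the maker marks 1 cell and the breaker marks 2 cells. For a set $\mathcal{S}$ of finite polyominoes, the maker wins if after finitely many moves he has marked all the cells of a set congruent to some element of $\mathcal{S}$; the breaker wins if she prevents this. $\mathcal{S}$ is a winner if the maker has a winning strategy. Ancestors. $P\sqsubseteq Q$ ($P$ is an ancestor of $Q$) means that $Q$ can be obtained from $P$ by adding some (possibly no) cells, i.e. some congruent copy of $P$ is a subset of $Q$. A team is a set of polyominoes no element of which is an ancestor of another element. Unbounded sets. A set of polyominoes is unbounded if it contains an infinite polyomino, and bounded otherwise. If $\mathcal{T}$ is unbounded and $F_T$ is a finite ancestor of $T$ for each $T\in\mathcal{T}$, then $\{F_T\mid T\in\mathcal{T}\}$ is a bounded restriction of $\mathcal{T}$. An unbounded set is a winner if each of its bounded restrictions is a winner. Simpler. $\mathcal{S}\preceq\mathcal{T}$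 ($\mathcal{S}$ is simpler than $\mathcal{T}$) means that for all $Q\in\mathcal{T}$ there is $P\in\mathcal{S}$ with $P\sqsubseteq Q$. Particular polyominoes (up to congruence): $S_n=\{(0,0),\dots,(n-1,0)\}$ for $n\ge1$; $S_\infty=\{(i,0)\mid i\ge0\}$ (only one end is infinite); $T_2=\{(0,0),(1,0),(2,0),(1,1)\}$; $C_n=S_n\cup\{(0,1),(n-1,1)\}$ and $Z_n=S_n\cup\{(0,1),(n-1,-1)\}$ for $n\ge2$.
   Formalization: The team is also assumed not to contain the straight polyomino infinite at both ends; with it the claim fails: that line together with the three-cell corner is a winning team that is not simpler than 𝒲. -}

module Defs where

open import Level using (0ℓ) renaming (suc to lsuc)
open import Data.Bool using (Bool; true; false)
open import Data.Fin using (Fin; zero; suc)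
open import Data.Integer as ℤ using (ℤ; +_; 0ℤ; 1ℤ; -1ℤ; ∣_∣)
import Data.Integer.Properties as ℤₚ
open import Data.List using (List; []; _∷_; length; map)
open import Data.List.Membership.Propositional using () renaming (_∈_ to _∈ˡ_; _∉_ to _∉ˡ_)
open import Data.List.Relation.Unary.Any using (Any)
open import Data.Nat as ℕ using (ℕ; zero; suc; z≤n; s≤s)
import Data.Nat.Properties as ℕₚ
open import Data.Product using (Σ-syntax; ∃-syntax; _×_; _,_; proj₁; proj₂)
open import Data.Sum using (_⊎_; inj₁; inj₂)
open import Function using (_∘_; _⇔_)
open import Relation.Binary using (Rel)
open import Relation.Binary.Construct.Closure.ReflexiveTransitive using (Star; ε; _◅_; _◅◅_; reverse)
open import Relation.Binary.PropositionalEquality using (_≡_; _≢_; refl; trans; cong; cong₂)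
open import Relation.Nullary using (¬_)
open import Relation.Unary using (Pred; _∈_; _⊆_; _∪_)

-- A cell is named by the lower left corner of the unit square.
Cell : Set
Cell = ℤ × ℤ

CellSet : Set₁
CellSet = Pred Cell 0ℓ

-- Two unit squares of the grid share an edge exactly when their names
-- are at Manhattan distance 1.
Adjacent : Rel Cell 0ℓ
Adjacent (x , y) (x′ , y′) = ∣ x ℤ.- x′ ∣ ℕ.+ ∣ y ℤ.- y′ ∣ ≡ 1

-- Every composite of translations by integer vectors, quarter turns and
-- reflections of the board is, on cells, a translation after a power of
-- the quarter turn (x , y) ↦ (- y , x) after at most one reflection.
record Congruence : Set where
  field
    mirrored : Bool
    turns    : Fin 4
    shift    : Cell

reflect : Bool → Cell → Cell
reflect false c       = c
reflect true  (x , y) = x , ℤ.- y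

rotate : Fin 4 → Cell → Cell
rotate zero                   (x , y) = x , y
rotate (suc zero)             (x , y) = ℤ.- y , x
rotate (suc (suc zero))       (x , y) = ℤ.- x , ℤ.- y
rotate (suc (suc (suc zero))) (x , y) = y , ℤ.- x

translate : Cell → Cell → Cell
translate (a , b) (x , y) = x ℤ.+ a , y ℤ.+ b

apply : Congruence → Cell → Cell
apply g = translate shift ∘ rotate turns ∘ reflect mirrored
  where open Congruence g

-- As apply g is a bijection, the condition says that B is the image of A
-- under g.
infix 4 _≅ᶜ_
_≅ᶜ_ : CellSet → CellSet → Set
A ≅ᶜ B = ∃[ g ] (∀ c → c ∈ A ⇔ apply g c ∈ B)

StepIn : CellSet → Rel Cell 0ℓ
StepIn A c d = c ∈ A × d ∈ A × Adjacent c d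

Connected : CellSet → Set
Connected A = ∀ {c d} → c ∈ A → d ∈ A → Star (StepIn A) c d

-- A polyomino proper is a class of these records modulo _≅_; every notion
-- below is invariant under _≅_.
record Polyomino : Set₁ where
  field
    cells     : CellSet
    nonempty  : ∃[ c ] c ∈ cells
    connected : Connected cells

open Polyomino public

infix 4 _≅_ _⊑_

_≅_ : Polyomino → Polyomino → Set
P ≅ Q = cells P ≅ᶜ cells Q

_⊑_ : Polyomino → Polyomino → Set
P ⊑ Q = ∃[ g ] (∀ {c} → c ∈ cells P → apply g c ∈ cells Q)

Finite : Polyomino → Set
Finite P = ∃[ cs ] (∀ {c} → c ∈ cells P → c ∈ˡ cs)

Infinite : Polyomino → Set
Infinite P = ¬ Finite P

-- The predicate need not be closed under _≅_: it stands for the set of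
-- the classes of its members.
PolyominoSet : Set₂
PolyominoSet = Pred Polyomino (lsuc 0ℓ)

infix 4 _⪯_
_⪯_ : PolyominoSet → PolyominoSet → Set₁
𝒮 ⪯ 𝒯 = ∀ {Q} → Q ∈ 𝒯 → ∃[ P ] (P ∈ 𝒮 × P ⊑ Q)

Team : PolyominoSet → Set₁
Team 𝒯 = ∀ {P Q} → P ∈ 𝒯 → Q ∈ 𝒯 → ¬ P ≅ Q → ¬ P ⊑ Q

-- Polyominoes are counted up to congruence.
FewerThan : ℕ → PolyominoSet → Set₁
FewerThan n 𝒯 = ∃[ Ps ] (length Ps ℕ.< n × (∀ {P} → P ∈ 𝒯 → Any (P ≅_) Ps))

Unbounded : PolyominoSet → Set₁
Unbounded 𝒯 = ∃[ P ] (P ∈ 𝒯 × Infinite P)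

Bounded : PolyominoSet → Set₁
Bounded 𝒯 = ¬ Unbounded 𝒯

-- The field respects makes T ↦ F_T a function of the class of T.
record Restriction (𝒯 : PolyominoSet) : Set₁ where
  field
    F        : ∀ {T} → T ∈ 𝒯 → Polyomino
    finite   : ∀ {T} (t : T ∈ 𝒯) → Finite (F t)
    ancestor : ∀ {T} (t : T ∈ 𝒯) → F t ⊑ T
    respects : ∀ {T T′} (t : T ∈ 𝒯) (t′ : T′ ∈ 𝒯) → T ≅ T′ → F t ≅ F t′

  members : PolyominoSet
  members P = ∃[ T ] Σ[ t ∈ T ∈ 𝒯 ] P ≡ F t

-- The maker's cell and the breaker's two cells.
Round : Set
Round = Cell × Cell × Cell

-- Completed rounds, latest first.
History : Set
History = List Round

makerCells : History → List Cell
makerCells = map proj₁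

marked : History → List Cell
marked []                = []
marked ((c , d , e) ∷ h) = c ∷ d ∷ e ∷ marked h

record MakerStrategy : Set where
  field
    move  : History → Cell
    legal : ∀ h → move h ∉ˡ marked h

record BreakerStrategy : Set where
  field
    reply₁ reply₂ : History → Cell → Cell
    distinct      : ∀ h c → reply₁ h c ≢ reply₂ h c
    legal₁        : ∀ h c → reply₁ h c ∉ˡ c ∷ marked h
    legal₂        : ∀ h c → reply₂ h c ∉ˡ c ∷ marked h

-- The first n rounds.
play : MakerStrategy → BreakerStrategy → ℕ → History
play σ β zero    = []
play σ β (suc n) = (c , reply₁ h c , reply₂ h c) ∷ h
  where
  open MakerStrategy σ
  open BreakerStrategy β
  h = play σ β n
  c = move h

Achieved : PolyominoSet → History → Set₁
Achieved 𝒮 h = ∃[ P ] (P ∈ 𝒮 × ∃[ g ] (∀ {c} → c ∈ cells P → apply g c ∈ˡ makerCells h))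

MakerWins : PolyominoSet → Set₁
MakerWins 𝒮 = Σ[ σ ∈ MakerStrategy ] (∀ β → ∃[ n ] Achieved 𝒮 (play σ β n))

Winner : PolyominoSet → Set₁
Winner 𝒯 = (Bounded 𝒯 × MakerWins 𝒯)
         ⊎ (Unbounded 𝒯 × (∀ (R : Restriction 𝒯) → MakerWins (Restriction.members R)))

S∞-cells : CellSet
S∞-cells c = ∃[ i ] c ≡ (+ i , 0ℤ)

S-cells : ℕ → CellSet
S-cells n c = ∃[ i ] (i ℕ.< n × c ≡ (+ i , 0ℤ))

⟨_,_⟩ : Cell → Cell → CellSet
⟨ a , b ⟩ c = c ≡ a ⊎ c ≡ b

T₂-cells : CellSet
T₂-cells = S-cells 3 ∪ (_≡ (1ℤ , 1ℤ))

C-cells : ℕ → CellSet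
C-cells n = S-cells n ∪ ⟨ (0ℤ , 1ℤ) , (+ n ℤ.- 1ℤ , 1ℤ) ⟩

Z-cells : ℕ → CellSet
Z-cells n = S-cells n ∪ ⟨ (0ℤ , 1ℤ) , (+ n ℤ.- 1ℤ , -1ℤ) ⟩

StepIn-sym : ∀ A {c d} → StepIn A c d → StepIn A d c
StepIn-sym A {c = x , y} {d = x′ , y′} (c∈A , d∈A , adj) =
  d∈A , c∈A , trans (cong₂ ℕ._+_ (ℤₚ.∣i-j∣≡∣j-i∣ x′ x) (ℤₚ.∣i-j∣≡∣j-i∣ y′ y)) adj

connected-via : ∀ {A} o → (∀ {c} → c ∈ A → Star (StepIn A) c o) → Connected A
connected-via {A} o toHub c∈A d∈A = toHub c∈A ◅◅ reverse (StepIn-sym A) (toHub d∈A)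

1+i-i : ∀ i → ∣ + suc i ℤ.- + i ∣ ≡ 1
1+i-i i = cong ∣_∣ (trans (ℤₚ.m-n≡m⊖n (suc i) i)
                   (trans (ℤₚ.⊖-≥ (ℕₚ.n≤1+n i)) (cong +_ (ℕₚ.m+n∸n≡m 1 i))))

row : ∀ {A} i → (∀ j → j ℕ.≤ i → (+ j , 0ℤ) ∈ A) → Star (StepIn A) (+ i , 0ℤ) (0ℤ , 0ℤ)
row zero    _   = ε
row (suc i) all =
  (all (suc i) ℕₚ.≤-refl , all i (ℕₚ.n≤1+n i) , cong (ℕ._+ 0) (1+i-i i))
  ◅ row i (λ j j≤i → all j (ℕₚ.m≤n⇒m≤1+n j≤i))

rowS : ∀ {A} n i → S-cells n ⊆ A → i ℕ.< n → Star (StepIn A) (+ i , 0ℤ) (0ℤ , 0ℤ)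
rowS n i S⊆A i<n = row i (λ j j≤i → S⊆A (j , ℕₚ.≤-<-trans j≤i i<n , refl))

vertical : ∀ x (u v : ℤ) → ∣ u ℤ.- v ∣ ≡ 1 → Adjacent (x , u) (x , v)
vertical x u v eq rewrite ℤₚ.+-inverseʳ x = eq

S∞ : Polyomino
S∞ .cells     = S∞-cells
S∞ .nonempty  = (0ℤ , 0ℤ) , 0 , refl
S∞ .connected = connected-via (0ℤ , 0ℤ) λ where
  (i , refl) → row i (λ j _ → j , refl)

T₂ : Polyomino
T₂ .cells     = T₂-cells
T₂ .nonempty  = (0ℤ , 0ℤ) , inj₁ (0 , s≤s z≤n , refl)
T₂ .connected = connected-via (0ℤ , 0ℤ) λ where
  (inj₁ (i , i<3 , refl)) → rowS 3 i inj₁ i<3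
  (inj₂ refl) → (inj₂ refl , inj₁ (1 , s≤s (s≤s z≤n) , refl) , refl)
              ◅ rowS 3 1 inj₁ (s≤s (s≤s z≤n))

C : ∀ n → 2 ℕ.≤ n → Polyomino
C n 2≤n .cells     = C-cells n
C n 2≤n .nonempty  = (0ℤ , 1ℤ) , inj₂ (inj₁ refl)
C n@(suc m) 2≤n .connected = connected-via (0ℤ , 0ℤ) λ where
  (inj₁ (i , i<n , refl)) → rowS n i inj₁ i<n
  (inj₂ (inj₁ refl)) → (inj₂ (inj₁ refl) , inj₁ (0 , s≤s z≤n , refl) , refl) ◅ ε
  (inj₂ (inj₂ refl)) →
    (inj₂ (inj₂ refl) , inj₁ (m , ℕₚ.≤-refl , refl) , vertical (+ m) 1ℤ 0ℤ refl)
    ◅ rowS n m inj₁ ℕₚ.≤-refl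

Z : ∀ n → 2 ℕ.≤ n → Polyomino
Z n 2≤n .cells     = Z-cells n
Z n 2≤n .nonempty  = (0ℤ , 1ℤ) , inj₂ (inj₁ refl)
Z n@(suc m) 2≤n .connected = connected-via (0ℤ , 0ℤ) λ where
  (inj₁ (i , i<n , refl)) → rowS n i inj₁ i<n
  (inj₂ (inj₁ refl)) → (inj₂ (inj₁ refl) , inj₁ (0 , s≤s z≤n , refl) , refl) ◅ ε
  (inj₂ (inj₂ refl)) →
    (inj₂ (inj₂ refl) , inj₁ (m , ℕₚ.≤-refl , refl) , vertical (+ m) -1ℤ 0ℤ refl)
    ◅ rowS n m inj₁ ℕₚ.≤-refl

data 𝒲 : PolyominoSet where
  S∞∈𝒲 : S∞ ∈ 𝒲
  T₂∈𝒲 : T₂ ∈ 𝒲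
  C∈𝒲  : ∀ n (2≤n : 2 ℕ.≤ n) → C n 2≤n ∈ 𝒲
  Z∈𝒲  : ∀ n (2≤n : 2 ℕ.≤ n) → Z n 2≤n ∈ 𝒲

-- The straight polyomino with two infinite ends must be kept out of the
-- teams: it has the same finite ancestors as S∞ but is not an ancestor
-- of S∞.  Together with the three-cell corner it forms a winning team
-- that is not simpler than 𝒲.
TwoEndedLine : CellSet
TwoEndedLine (x , y) = y ≡ 0ℤ

NoTwoEndedLine : PolyominoSet → Set₁
NoTwoEndedLine 𝒯 = ∀ {P} → P ∈ 𝒯 → ¬ cells P ≅ᶜ TwoEndedLine

{-# OPTIONS --safe #-}
module Submission where

-- The breaker fixes a graph on the board in which every cell has two neighbours
-- and answers each cell by marking its neighbours; the maker then never owns an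
-- edge.  Suitable periodic graphs have an edge in every copy of
--   the corner V;  S₃ and the skew tetromino;  S₃, the square and the
--   five-cell staircase;  all tetrominoes but T;  all tetrominoes but L.
-- As V is below every tetromino but the straight one, and S₃ is below the straight,
-- T and L ones, these graphs also show that the set of all tetrominoes but any single
-- one is a loser.
--
-- If ℱ contains no ancestor of V or S₃, then every member has a tetromino as an
-- ancestor; being fewer than five, the members can avoid one tetromino.  So ℱ is
-- a loser, and it is not simpler than 𝒲 either, because S∞, T₂, C 2, Z 2 and C 3
-- have each exactly one tetromino below them, all five different.  Otherwise both
-- conditions say that ℱ contains an ancestor of S∞ and, moreover, an ancestor of V
-- or ancestors of S₃, of the square and of the skew tetromino.  Then the maker wins
-- by counting: after n rounds only 3 n cells are marked.

open import Level using (0ℓ; lift; lower) renaming (suc to lsuc)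
open import Axiom.ExcludedMiddle using (ExcludedMiddle)
open import Data.Bool using (Bool; true; false; not)
open import Data.Empty using (⊥; ⊥-elim)
open import Data.Fin using (Fin; zero; suc)
open import Data.Fin.Properties using () renaming (any? to anyFin?; all? to allFin?)
open import Data.Integer as ℤ using (ℤ; +_; -[1+_]; 0ℤ; 1ℤ; -1ℤ; ∣_∣)
import Data.Integer.Properties as ℤₚ
open import Algebra.Properties.CommutativeSemigroup ℤₚ.+-commutativeSemigroup using (interchange)
open import Data.List using (List; []; _∷_; _++_; concatMap; deduplicate; filter; length; map)
import Data.List.Membership.DecPropositional as DecMembership
open import Data.List.Membership.Propositional using (find; lose) renaming (_∈_ to _∈ˡ_; _∉_ to _∉ˡ_)
open import Data.List.Membership.Propositional.Properties
  using (∈-++⁻; ∈-concatMap⁺; ∈-deduplicate⁻; ∈-filter⁺; ∈-map⁺; ∈-map⁻)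
open import Data.List.Properties using (filter-notAll; length-map) renaming (≡-dec to List-≡-dec)
open import Data.List.Relation.Unary.All as All using (All; []; _∷_; all?)
open import Data.List.Relation.Unary.All.Properties using (¬Any⇒All¬)
open import Data.List.Relation.Unary.AllPairs using ([]; _∷_)
open import Data.List.Relation.Unary.Any as Any using (Any; here; there; any?)
open import Data.List.Relation.Unary.Unique.DecPropositional using (unique?)
open import Data.List.Relation.Unary.Unique.DecPropositional.Properties using (deduplicate-!)
open import Data.List.Relation.Unary.Unique.Propositional using (Unique)
import Data.List.Relation.Unary.Unique.Propositional.Properties as Uniqueₚ
open import Data.Maybe using (Maybe; just; nothing)
open import Data.Nat as ℕ using (ℕ; zero; suc; z≤n; s≤s)
import Data.Nat.Properties as ℕₚ
open import Data.Product using (∃-syntax; _×_; _,_; proj₁; proj₂; map₂)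
open import Data.Product.Properties using () renaming (≡-dec to ×-≡-dec)
open import Data.Sum using (_⊎_; inj₁; inj₂; [_,_]′)
open import Data.Unit using (⊤; tt)
open import Function using (_∘_; _⇔_; Equivalence; id; mk⇔)
open import Relation.Binary.Construct.Closure.ReflexiveTransitive as Star using (Star; ε; _◅_; gmap)
open import Relation.Binary.Definitions using (DecidableEquality)
open import Relation.Binary.PropositionalEquality
open import Relation.Nullary using (¬_; Dec; yes; no; ¬?; contradiction)
open import Relation.Nullary.Decidable using (_×-dec_; _⊎-dec_; decidable-stable; from-yes; map′)
open import Relation.Unary using (_∈_)
open import Defs

-- Cells and congruences

infix 4 _≟ᶜ_
_≟ᶜ_ : DecidableEquality Cell
_≟ᶜ_ = ×-≡-dec ℤ._≟_ ℤ._≟_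

origin : Cell
origin = 0ℤ , 0ℤ

infixl 6 _+ᶜ_
_+ᶜ_ : Cell → Cell → Cell
c +ᶜ d = translate d c

-ᶜ_ : Cell → Cell
-ᶜ (x , y) = ℤ.- x , ℤ.- y

+ᶜ-assoc : ∀ a b c → a +ᶜ b +ᶜ c ≡ a +ᶜ (b +ᶜ c)
+ᶜ-assoc (a , a′) (b , b′) (c , c′) = cong₂ _,_ (ℤₚ.+-assoc a b c) (ℤₚ.+-assoc a′ b′ c′)

+ᶜ-comm : ∀ a b → a +ᶜ b ≡ b +ᶜ a
+ᶜ-comm (a , a′) (b , b′) = cong₂ _,_ (ℤₚ.+-comm a b) (ℤₚ.+-comm a′ b′)

+ᶜ-inverseʳ : ∀ a → a +ᶜ -ᶜ a ≡ origin
+ᶜ-inverseʳ (a , a′) = cong₂ _,_ (ℤₚ.+-inverseʳ a) (ℤₚ.+-inverseʳ a′)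

+ᶜ-identityʳ : ∀ a → a +ᶜ origin ≡ a
+ᶜ-identityʳ (a , a′) = cong₂ _,_ (ℤₚ.+-identityʳ a) (ℤₚ.+-identityʳ a′)

+ᶜ-cancelʳ : ∀ a b → a +ᶜ b +ᶜ -ᶜ b ≡ a
+ᶜ-cancelʳ a b = trans (+ᶜ-assoc a b (-ᶜ b)) (trans (cong (a +ᶜ_) (+ᶜ-inverseʳ b)) (+ᶜ-identityʳ a))

+ᶜ-difference : ∀ a b → a +ᶜ (b +ᶜ -ᶜ a) ≡ b
+ᶜ-difference a b = trans (+ᶜ-comm a _) (trans (+ᶜ-assoc b (-ᶜ a) a)
  (trans (cong (b +ᶜ_) (trans (+ᶜ-comm (-ᶜ a) a) (+ᶜ-inverseʳ a))) (+ᶜ-identityʳ b)))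

pattern 0ᶠ = zero
pattern 1ᶠ = suc zero
pattern 2ᶠ = suc (suc zero)
pattern 3ᶠ = suc (suc (suc zero))

-- The dihedral group of orientations

Orientation : Set
Orientation = Bool × Fin 4

orient : Orientation → Cell → Cell
orient (m , k) c = rotate k (reflect m c)

rotate-+ : ∀ k a b → rotate k (a +ᶜ b) ≡ rotate k a +ᶜ rotate k b
rotate-+ 0ᶠ a b = refl
rotate-+ 1ᶠ (a , a′) (b , b′) = cong (_, a ℤ.+ b) (ℤₚ.neg-distrib-+ a′ b′)
rotate-+ 2ᶠ (a , a′) (b , b′) = cong₂ _,_ (ℤₚ.neg-distrib-+ a b) (ℤₚ.neg-distrib-+ a′ b′)
rotate-+ 3ᶠ (a , a′) (b , b′) = cong (a′ ℤ.+ b′ ,_) (ℤₚ.neg-distrib-+ a b)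

reflect-+ : ∀ m a b → reflect m (a +ᶜ b) ≡ reflect m a +ᶜ reflect m b
reflect-+ false a b = refl
reflect-+ true (a , a′) (b , b′) = cong (a ℤ.+ b ,_) (ℤₚ.neg-distrib-+ a′ b′)

orient-+ : ∀ o a b → orient o (a +ᶜ b) ≡ orient o a +ᶜ orient o b
orient-+ (m , k) a b = trans (cong (rotate k) (reflect-+ m a b)) (rotate-+ k (reflect m a) (reflect m b))

next : Fin 4 → Fin 4
next 0ᶠ = 1ᶠ
next 1ᶠ = 2ᶠ
next 2ᶠ = 3ᶠ
next 3ᶠ = 0ᶠ

opposite : Fin 4 → Fin 4
opposite 0ᶠ = 0ᶠ
opposite 1ᶠ = 3ᶠ
opposite 2ᶠ = 2ᶠ
opposite 3ᶠ = 1ᶠ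

infixl 6 _⟲_
_⟲_ : Fin 4 → Fin 4 → Fin 4
0ᶠ ⟲ l = l
1ᶠ ⟲ l = next l
2ᶠ ⟲ l = next (next l)
3ᶠ ⟲ l = next (next (next l))

rotate-next : ∀ k c → rotate 1ᶠ (rotate k c) ≡ rotate (next k) c
rotate-next 0ᶠ c       = refl
rotate-next 1ᶠ c       = refl
rotate-next 2ᶠ (x , y) = cong (_, ℤ.- x) (ℤₚ.neg-involutive y)
rotate-next 3ᶠ (x , y) = cong (_, y) (ℤₚ.neg-involutive x)

rotate-∘ : ∀ k l c → rotate k (rotate l c) ≡ rotate (k ⟲ l) c
rotate-∘ 0ᶠ l c = refl
rotate-∘ 1ᶠ l c = rotate-next l c
rotate-∘ 2ᶠ l c = trans (cong (rotate 1ᶠ) (rotate-next l c)) (rotate-next (next l) c)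
rotate-∘ 3ᶠ l c = trans (sym (rotate-next 2ᶠ (rotate l c)))
  (trans (cong (rotate 1ᶠ) (rotate-∘ 2ᶠ l c)) (rotate-next (next (next l)) c))

reflect-rotate : ∀ k c → reflect true (rotate k c) ≡ rotate (opposite k) (reflect true c)
reflect-rotate 0ᶠ (x , y) = refl
reflect-rotate 1ᶠ (x , y) = refl
reflect-rotate 2ᶠ (x , y) = refl
reflect-rotate 3ᶠ (x , y) = cong₂ _,_ (sym (ℤₚ.neg-involutive y)) (ℤₚ.neg-involutive x)

reflect-∘ : ∀ m c → reflect true (reflect m c) ≡ reflect (not m) c
reflect-∘ false c       = refl
reflect-∘ true  (x , y) = cong (x ,_) (ℤₚ.neg-involutive y)

infixl 6 _·_
-- The product of the dihedral group of order 8. By `reflect-rotate`, moving a reflection past a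
-- turn reverses the turn.
_·_ : Orientation → Orientation → Orientation
(false , k) · (m , l) = m , k ⟲ l
(true  , k) · (m , l) = not m , k ⟲ opposite l

orient-· : ∀ o p c → orient o (orient p c) ≡ orient (o · p) c
orient-· (false , k) (m , l) c = rotate-∘ k l (reflect m c)
orient-· (true , k) (m , l) c = trans (cong (rotate k) (reflect-rotate l (reflect m c)))
  (trans (rotate-∘ k (opposite l) _) (cong (rotate (k ⟲ opposite l)) (reflect-∘ m c)))

inverse : Orientation → Orientation
inverse (false , k) = false , opposite k
inverse (true  , k) = true , k

inverse-·ˡ : ∀ o → inverse o · o ≡ (false , 0ᶠ)
inverse-·ˡ (false , 0ᶠ) = refl
inverse-·ˡ (false , 1ᶠ) = refl
inverse-·ˡ (false , 2ᶠ) = refl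
inverse-·ˡ (false , 3ᶠ) = refl
inverse-·ˡ (true  , 0ᶠ) = refl
inverse-·ˡ (true  , 1ᶠ) = refl
inverse-·ˡ (true  , 2ᶠ) = refl
inverse-·ˡ (true  , 3ᶠ) = refl

inverse-involutive : ∀ o → inverse (inverse o) ≡ o
inverse-involutive (false , 0ᶠ) = refl
inverse-involutive (false , 1ᶠ) = refl
inverse-involutive (false , 2ᶠ) = refl
inverse-involutive (false , 3ᶠ) = refl
inverse-involutive (true  , _)  = refl

orient-inverse : ∀ o c → orient (inverse o) (orient o c) ≡ c
orient-inverse o c = trans (orient-· (inverse o) o c)
  (cong (λ p → orient p c) {y = false , 0ᶠ} (inverse-·ˡ o))

orient-inverse′ : ∀ o c → orient o (orient (inverse o) c) ≡ c
orient-inverse′ o c = subst (λ p → orient p (orient (inverse o) c) ≡ c) (inverse-involutive o)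
  (orient-inverse (inverse o) c)

open Congruence

placed : Orientation → Cell → Congruence
placed (m , k) s = record { mirrored = m ; turns = k ; shift = s }

orientation : Congruence → Orientation
orientation g = mirrored g , turns g

infixl 6 _∙_
_∙_ : Congruence → Congruence → Congruence
g ∙ h = placed (orientation g · orientation h) (orient (orientation g) (shift h) +ᶜ shift g)

apply-∙ : ∀ g h c → apply (g ∙ h) c ≡ apply g (apply h c)
apply-∙ g h c = begin
  orient (o · p) c +ᶜ (orient o t +ᶜ s)        ≡⟨ cong (_+ᶜ (orient o t +ᶜ s)) (orient-· o p c) ⟨
  orient o (orient p c) +ᶜ (orient o t +ᶜ s)   ≡⟨ +ᶜ-assoc (orient o (orient p c)) _ _ ⟨
  orient o (orient p c) +ᶜ orient o t +ᶜ s     ≡⟨ cong (_+ᶜ s) (orient-+ o (orient p c) t) ⟨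
  orient o (orient p c +ᶜ t) +ᶜ s              ∎
  where
  open ≡-Reasoning
  o = orientation g
  p = orientation h
  s = shift g
  t = shift h

identity : Congruence
identity = placed (false , 0ᶠ) origin

apply-identity : ∀ c → apply identity c ≡ c
apply-identity = +ᶜ-identityʳ

shifting : Cell → Congruence
shifting = placed (false , 0ᶠ)

_⁻¹ : Congruence → Congruence
g ⁻¹ = placed o′ (orient o′ (-ᶜ shift g))
  where o′ = inverse (orientation g)

apply-⁻¹ˡ : ∀ g c → apply (g ⁻¹) (apply g c) ≡ c
apply-⁻¹ˡ g c = begin
  orient o′ (orient o c +ᶜ s) +ᶜ orient o′ (-ᶜ s)   ≡⟨ orient-+ o′ (orient o c +ᶜ s) (-ᶜ s) ⟨
  orient o′ (orient o c +ᶜ s +ᶜ -ᶜ s)               ≡⟨ cong (orient o′) (+ᶜ-cancelʳ (orient o c) s) ⟩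
  orient o′ (orient o c)                            ≡⟨ orient-inverse o c ⟩
  c                                                 ∎
  where
  open ≡-Reasoning
  o  = orientation g
  o′ = inverse o
  s  = shift g

apply-⁻¹ʳ : ∀ g c → apply g (apply (g ⁻¹) c) ≡ c
apply-⁻¹ʳ g c = begin
  orient o (orient o′ c +ᶜ orient o′ (-ᶜ s)) +ᶜ s   ≡⟨ cong (λ d → orient o d +ᶜ s) (orient-+ o′ c (-ᶜ s)) ⟨
  orient o (orient o′ (c +ᶜ -ᶜ s)) +ᶜ s             ≡⟨ cong (_+ᶜ s) (orient-inverse′ o (c +ᶜ -ᶜ s)) ⟩
  c +ᶜ -ᶜ s +ᶜ s                                    ≡⟨ trans (+ᶜ-comm _ s) (+ᶜ-difference s c) ⟩
  c                                                 ∎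
  where
  open ≡-Reasoning
  o  = orientation g
  o′ = inverse o
  s  = shift g

apply-injective : ∀ g {c d} → apply g c ≡ apply g d → c ≡ d
apply-injective g {c} {d} eq = trans (sym (apply-⁻¹ˡ g c)) (trans (cong (apply (g ⁻¹)) eq) (apply-⁻¹ˡ g d))

∣-∣-translate : ∀ a x x′ → ∣ x ℤ.+ a ℤ.- (x′ ℤ.+ a) ∣ ≡ ∣ x ℤ.- x′ ∣
∣-∣-translate a x x′ = cong ∣_∣ (begin
  x ℤ.+ a ℤ.- (x′ ℤ.+ a)             ≡⟨ cong (λ z → x ℤ.+ a ℤ.- z) (ℤₚ.+-comm x′ a) ⟩
  x ℤ.+ a ℤ.- (a ℤ.+ x′)             ≡⟨ cong (λ z → x ℤ.+ a ℤ.+ z) (ℤₚ.neg-distrib-+ a x′) ⟩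
  x ℤ.+ a ℤ.+ (ℤ.- a ℤ.+ ℤ.- x′)     ≡⟨ ℤₚ.+-assoc (x ℤ.+ a) (ℤ.- a) (ℤ.- x′) ⟨
  x ℤ.+ a ℤ.- a ℤ.- x′               ≡⟨ cong (ℤ._- x′) (ℤₚ.+-assoc x a (ℤ.- a)) ⟩
  x ℤ.+ (a ℤ.- a) ℤ.- x′             ≡⟨ cong (λ z → x ℤ.+ z ℤ.- x′) (ℤₚ.+-inverseʳ a) ⟩
  x ℤ.+ 0ℤ ℤ.- x′                    ≡⟨ cong (ℤ._- x′) (ℤₚ.+-identityʳ x) ⟩
  x ℤ.- x′                           ∎)
  where open ≡-Reasoning

∣-∣-neg : ∀ x x′ → ∣ ℤ.- x ℤ.- (ℤ.- x′) ∣ ≡ ∣ x ℤ.- x′ ∣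
∣-∣-neg x x′ = trans (cong ∣_∣ (sym (ℤₚ.neg-distrib-+ x (ℤ.- x′)))) (ℤₚ.∣-i∣≡∣i∣ (x ℤ.- x′))

Adjacent-translate : ∀ s c d → Adjacent c d → Adjacent (translate s c) (translate s d)
Adjacent-translate (a , b) (x , y) (x′ , y′) adj =
  trans (cong₂ ℕ._+_ (∣-∣-translate a x x′) (∣-∣-translate b y y′)) adj

Adjacent-rotate : ∀ k c d → Adjacent c d → Adjacent (rotate k c) (rotate k d)
Adjacent-rotate 0ᶠ _ _ adj = adj
Adjacent-rotate 1ᶠ (x , y) (x′ , y′) adj =
  trans (cong (ℕ._+ _) (∣-∣-neg y y′)) (trans (ℕₚ.+-comm ∣ y ℤ.- y′ ∣ _) adj)
Adjacent-rotate 2ᶠ (x , y) (x′ , y′) adj = trans (cong₂ ℕ._+_ (∣-∣-neg x x′) (∣-∣-neg y y′)) adj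
Adjacent-rotate 3ᶠ (x , y) (x′ , y′) adj =
  trans (cong (_ ℕ.+_) (∣-∣-neg x x′)) (trans (ℕₚ.+-comm ∣ y ℤ.- y′ ∣ _) adj)

Adjacent-reflect : ∀ m c d → Adjacent c d → Adjacent (reflect m c) (reflect m d)
Adjacent-reflect false _ _ adj = adj
Adjacent-reflect true (x , y) (x′ , y′) adj = trans (cong (∣ x ℤ.- x′ ∣ ℕ.+_) (∣-∣-neg y y′)) adj

Adjacent-apply : ∀ g c d → Adjacent c d → Adjacent (apply g c) (apply g d)
Adjacent-apply g c d adj = Adjacent-translate (shift g) (orient (orientation g) c) (orient (orientation g) d)
  (Adjacent-rotate (turns g) (reflect (mirrored g) c) (reflect (mirrored g) d)
    (Adjacent-reflect (mirrored g) c d adj))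

Adjacent-sym : ∀ c d → Adjacent c d → Adjacent d c
Adjacent-sym (x , y) (x′ , y′) adj =
  trans (cong₂ ℕ._+_ (ℤₚ.∣i-j∣≡∣j-i∣ x′ x) (ℤₚ.∣i-j∣≡∣j-i∣ y′ y)) adj

units : List Cell
units = (1ℤ , 0ℤ) ∷ (-1ℤ , 0ℤ) ∷ (0ℤ , 1ℤ) ∷ (0ℤ , -1ℤ) ∷ []

open DecMembership _≟ᶜ_ using (_∈?_)

neighbours : Cell → List Cell
neighbours c = map (c +ᶜ_) units

length-1⇒unit : ∀ u v → ∣ u ∣ ℕ.+ ∣ v ∣ ≡ 1 → (u , v) ∈ˡ units
length-1⇒unit (+ 1)      (+ 0)       refl = here refl
length-1⇒unit (-[1+ 0 ]) (+ 0)       refl = there (here refl)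
length-1⇒unit (+ 0)      (+ 1)       refl = there (there (here refl))
length-1⇒unit (+ 0)      (-[1+ 0 ])  refl = there (there (there (here refl)))

Adjacent⇒neighbour : ∀ c d → Adjacent c d → d ∈ˡ neighbours c
Adjacent⇒neighbour (x , y) (x′ , y′) adj = subst (_∈ˡ neighbours (x , y)) (+ᶜ-difference (x , y) (x′ , y′))
  (∈-map⁺ ((x , y) +ᶜ_) (length-1⇒unit (x′ ℤ.- x) (y′ ℤ.- y)
    (Adjacent-sym (x , y) (x′ , y′) adj)))

-- Finite shapes and their copies

Shape : Set
Shape = List Cell

infix 4 _↪_ _⊑ˢ_ _ˢ⊑_ _ˢ⊑ˢ_ _ˢ⊑ˢ?_

_↪_ : CellSet → CellSet → Set
A ↪ B = ∃[ g ] (∀ {c} → c ∈ A → apply g c ∈ B)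

↪-trans : ∀ {A B C} → A ↪ B → B ↪ C → A ↪ C
↪-trans {C = C} (g , A⊆B) (h , B⊆C) = h ∙ g ,
  λ {c} c∈A → subst C (sym (apply-∙ h g c)) (B⊆C (A⊆B c∈A))

-- A superscript ˢ marks the side on which a finite list of cells stands.
_⊑ˢ_ : Polyomino → Shape → Set
P ⊑ˢ X = cells P ↪ (_∈ˡ X)

_ˢ⊑_ : Shape → CellSet → Set
X ˢ⊑ A = ∃[ g ] All (λ c → apply g c ∈ A) X

_ˢ⊑ˢ_ : Shape → Shape → Set
X ˢ⊑ˢ Y = X ˢ⊑ (_∈ˡ Y)

allOrientations? : ∀ {P : Orientation → Set} → (∀ o → Dec (P o)) → Dec (∀ o → P o)
allOrientations? {P} P? = map′ glue split (allFin? (λ k → P? (false , k)) ×-dec allFin? (λ k → P? (true , k)))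
  where
  glue : _ → ∀ o → P o
  glue (f , t) (false , k) = f k
  glue (f , t) (true  , k) = t k
  split : (∀ o → P o) → _
  split f = (λ k → f (false , k)) , (λ k → f (true , k))

anyOrientation? : ∀ {P : Orientation → Set} → (∀ o → Dec (P o)) → Dec (∃[ o ] P o)
anyOrientation? {P} P? = map′ glue split (anyFin? (λ k → P? (false , k)) ⊎-dec anyFin? (λ k → P? (true , k)))
  where
  glue : _ → ∃[ o ] P o
  glue (inj₁ (k , p)) = (false , k) , p
  glue (inj₂ (k , p)) = (true , k) , p
  split : (∃[ o ] P o) → _
  split ((false , k) , p) = inj₁ (k , p)
  split ((true  , k) , p) = inj₂ (k , p)

-- The image of the first cell of X must be one of the cells of Y, so that
-- only finitely many shifts have to be tried.
_ˢ⊑ˢ?_ : ∀ X Y → Dec (X ˢ⊑ˢ Y)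
[]         ˢ⊑ˢ? Y = yes (identity , [])
X@(x ∷ _) ˢ⊑ˢ? Y = map′ to from (anyOrientation? λ o → any? (λ y → all? (λ c → _ ∈? Y) X) Y)
  where
  at : Orientation → Cell → Congruence
  at o y = placed o (y +ᶜ -ᶜ orient o x)

  to : (∃[ o ] Any (λ y → All (λ c → apply (at o y) c ∈ˡ Y) X) Y) → X ˢ⊑ˢ Y
  to (o , anchored) = let (y , _ , all) = find anchored in at o y , all

  from : X ˢ⊑ˢ Y → ∃[ o ] Any (λ y → All (λ c → apply (at o y) c ∈ˡ Y) X) Y
  from (g , all) = orientation g , lose (All.head all)
    (subst (λ s → All (λ c → apply (placed (orientation g) s) c ∈ˡ Y) X) s≡ all)
    where
    s  = shift g
    x′ = orient (orientation g) x
    s≡ : s ≡ x′ +ᶜ s +ᶜ -ᶜ x′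
    s≡ = sym (trans (cong (_+ᶜ -ᶜ x′) (+ᶜ-comm x′ s)) (+ᶜ-cancelʳ s x′))

ˢ⊑⇒↪ : ∀ {X A} → X ˢ⊑ A → (_∈ˡ X) ↪ A
ˢ⊑⇒↪ (g , all) = g , All.lookup all

ˢ⊑-↪-trans : ∀ {X A B} → X ˢ⊑ A → A ↪ B → X ˢ⊑ B
ˢ⊑-↪-trans {B = B} (g , all) (h , A⊆B) = h ∙ g ,
  All.map (λ {c} c∈A → subst B (sym (apply-∙ h g c)) (A⊆B c∈A)) all

ˢ⊑ˢ-trans : ∀ {X Y A} → X ˢ⊑ˢ Y → Y ˢ⊑ A → X ˢ⊑ A
ˢ⊑ˢ-trans {X} {Y} {A} X⊑Y Y⊑A = ˢ⊑-↪-trans {X} {_∈ˡ Y} {A} X⊑Y (ˢ⊑⇒↪ {Y} {A} Y⊑A)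

ˢ⊑-trans : ∀ {X P Q} → X ˢ⊑ cells P → P ⊑ Q → X ˢ⊑ cells Q
ˢ⊑-trans {X} {P} {Q} = ˢ⊑-↪-trans {X} {cells P} {cells Q}

ˢ⊑-⊑ˢ-trans : ∀ {X P Y} → X ˢ⊑ cells P → P ⊑ˢ Y → X ˢ⊑ˢ Y
ˢ⊑-⊑ˢ-trans {X} {P} {Y} = ˢ⊑-↪-trans {X} {cells P} {_∈ˡ Y}

⊑-trans : ∀ {P Q R} → P ⊑ Q → Q ⊑ R → P ⊑ R
⊑-trans {P} {Q} {R} = ↪-trans {cells P} {cells Q} {cells R}

⊑-⊑ˢ-trans : ∀ {P Q X} → P ⊑ Q → Q ⊑ˢ X → P ⊑ˢ X
⊑-⊑ˢ-trans {P} {Q} {X} = ↪-trans {cells P} {cells Q} {_∈ˡ X}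

⊑ˢ-ˢ⊑-trans : ∀ {P X Q} → P ⊑ˢ X → X ˢ⊑ cells Q → P ⊑ Q
⊑ˢ-ˢ⊑-trans {P} {X} {Q} P⊑X X⊑Q = ↪-trans {cells P} {_∈ˡ X} {cells Q} P⊑X (ˢ⊑⇒↪ {X} {cells Q} X⊑Q)

⊑ˢ-mono : ∀ {P X Y} → P ⊑ˢ X → X ˢ⊑ˢ Y → P ⊑ˢ Y
⊑ˢ-mono {P} {X} {Y} P⊑X X⊑Y = ↪-trans {cells P} {_∈ˡ X} {_∈ˡ Y} P⊑X (ˢ⊑⇒↪ {X} {_∈ˡ Y} X⊑Y)

≅⇒⊑ : ∀ {P Q} → P ≅ Q → P ⊑ Q
≅⇒⊑ (g , eq) = g , λ {c} → Equivalence.to (eq c)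

≅-sym : ∀ {P Q} → P ≅ Q → Q ≅ P
≅-sym {P} {Q} (g , eq) = g ⁻¹ , λ c → mk⇔
  (λ c∈Q → Equivalence.from (eq (apply (g ⁻¹) c)) (subst (cells Q) (sym (apply-⁻¹ʳ g c)) c∈Q))
  (λ c∈P → subst (cells Q) (apply-⁻¹ʳ g c) (Equivalence.to (eq (apply (g ⁻¹) c)) c∈P))

-- Normalises the position: when `g` carries a shape into `P`, the shape itself lies in
-- `preimage g P`, at its given coordinates.
preimage : Congruence → Polyomino → Polyomino
preimage g P .cells c   = apply g c ∈ cells P
preimage g P .nonempty  = let (c , c∈P) = nonempty P in
  apply (g ⁻¹) c , subst (cells P) (sym (apply-⁻¹ʳ g c)) c∈P
preimage g P .connected {c} {d} c∈ d∈ = subst₂ (Star (StepIn _)) (apply-⁻¹ˡ g c) (apply-⁻¹ˡ g d)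
  (gmap (apply (g ⁻¹)) step (connected P c∈ d∈))
  where
  step : ∀ {a b} → StepIn (cells P) a b → StepIn (cells (preimage g P)) (apply (g ⁻¹) a) (apply (g ⁻¹) b)
  step {a} {b} (a∈ , b∈ , adj) = subst (cells P) (sym (apply-⁻¹ʳ g a)) a∈ ,
    subst (cells P) (sym (apply-⁻¹ʳ g b)) b∈ , Adjacent-apply (g ⁻¹) a b adj

preimage-≅ : ∀ g P → preimage g P ≅ P
preimage-≅ g P = g , λ c → mk⇔ id id

-- Growing connected sets across the boundary

module _ (X : Shape) where

  boundary : List Cell
  boundary = filter (λ c → ¬? (c ∈? X)) (concatMap neighbours X)

  Adjacent⇒boundary : ∀ c d → c ∈ˡ X → d ∉ˡ X → Adjacent c d → d ∈ˡ boundary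
  Adjacent⇒boundary c d c∈X d∉X adj = ∈-filter⁺ (λ c → ¬? (c ∈? X))
    (∈-concatMap⁺ neighbours (lose c∈X (Adjacent⇒neighbour c d adj))) d∉X

  -- The first cell of the path outside `X` is adjacent to a cell of `X`, namely the one before it.
  exit : ∀ {A : CellSet} {c d} → c ∈ˡ X → d ∉ˡ X → Star (StepIn A) c d → ∃[ e ] (e ∈ˡ boundary × e ∈ A)
  exit c∈X d∉X ε = contradiction c∈X d∉X
  exit {c = c} c∈X d∉X (_◅_ {j = e} (_ , e∈A , adj) path) with e ∈? X
  ... | yes e∈X = exit e∈X d∉X path
  ... | no  e∉X = e , Adjacent⇒boundary c e c∈X e∉X adj , e∈A

-- Case analyses on how a polyomino continues beyond `X` reduce to this finite check, which
-- `extends?` settles by evaluation.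
Extends : List Shape → Shape → Set
Extends 𝒬 X = All (λ c → Any (_ˢ⊑ˢ (c ∷ X)) 𝒬) (boundary X)

extends? : ∀ 𝒬 X → Dec (Extends 𝒬 X)
extends? 𝒬 X = all? (λ c → any? (_ˢ⊑ˢ? (c ∷ X)) 𝒬) (boundary X)

-- `V` is the corner, `I`, `T`, `O`, `S`, `L` are the straight, T, square, skew and L tetrominoes,
-- `W` is the staircase of five cells. The lists grow at the front, each new cell touching an older
-- one.
S₁ S₂ S₃ V I T O S L W : Shape
S₁ = origin ∷ []
S₂ = (1ℤ , 0ℤ) ∷ S₁
S₃ = (+ 2 , 0ℤ) ∷ S₂
V  = (0ℤ , 1ℤ) ∷ S₂
I  = (+ 3 , 0ℤ) ∷ S₃
T  = (1ℤ , 1ℤ) ∷ S₃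
O  = (1ℤ , 1ℤ) ∷ V
S  = (1ℤ , -1ℤ) ∷ V
L  = (0ℤ , 1ℤ) ∷ S₃
W  = (+ 2 , -1ℤ) ∷ S

tetrominoes : List Shape
tetrominoes = I ∷ T ∷ O ∷ S ∷ L ∷ []

-- discrete intermediate values
crossing : ∀ {A c d} x → (∀ {e} → e ∈ A → proj₂ e ≡ 0ℤ) → Star (StepIn A) c d → d ∈ A →
           proj₁ c ℤ.≤ x → x ℤ.≤ proj₁ d → (x , 0ℤ) ∈ A
crossing {A} {c} x flat ε d∈A c≤x x≤d =
  subst A (cong₂ _,_ (ℤₚ.≤-antisym c≤x x≤d) (flat d∈A)) d∈A
crossing {A} {a , b} x flat (_◅_ {j = a′ , b′} (c∈A , e∈A , adj) path) d∈A c≤x x≤d with a′ ℤ.≤? x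
... | yes e≤x = crossing x flat path d∈A e≤x x≤d
-- The next cell lies to the right of `x`, and a step gains at most 1; so the current cell has first
-- coordinate `x`.
... | no  e≰x = subst A (cong₂ _,_ (ℤₚ.≤-antisym c≤x x≤a) (flat c∈A)) c∈A
  where
  step≤1 : ∀ a b {a′ b′} → (a′ , b′) ∈ˡ neighbours (a , b) → a′ ℤ.≤ a ℤ.+ 1ℤ
  step≤1 a b (here refl)                         = ℤₚ.≤-refl
  step≤1 a b (there (here refl))                 = ℤₚ.+-monoʳ-≤ a ℤ.-≤+
  step≤1 a b (there (there (here refl)))         = ℤₚ.+-monoʳ-≤ a (ℤ.+≤+ ℕ.z≤n)
  step≤1 a b (there (there (there (here refl)))) = ℤₚ.+-monoʳ-≤ a (ℤ.+≤+ ℕ.z≤n)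
  x≤a : x ℤ.≤ a
  x≤a = ℤₚ.≮⇒≥ λ a<x → ℤₚ.<-irrefl refl (begin-strict
    x            <⟨ ℤₚ.≰⇒> e≰x ⟩
    a′           ≤⟨ step≤1 a b (Adjacent⇒neighbour (a , b) (a′ , b′) adj) ⟩
    a ℤ.+ 1ℤ     ≡⟨ ℤₚ.+-comm a 1ℤ ⟩
    ℤ.suc a      ≤⟨ ℤₚ.i<j⇒suc[i]≤j a<x ⟩
    x            ∎)
    where open ℤₚ.≤-Reasoning

-- Sets without a corner

module _ {A : CellSet} (no-V : ¬ V ˢ⊑ A) where

  -- The horizontal neighbour strengthens the invariant: together with it, a vertical step from `c`
  -- would form a corner.
  Flat : Cell → Set
  Flat c = proj₂ c ≡ 0ℤ × (c +ᶜ (1ℤ , 0ℤ) ∈ A ⊎ c +ᶜ (-1ℤ , 0ℤ) ∈ A)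

  corner : ∀ {c u v} o → orient o (1ℤ , 0ℤ) ≡ u → orient o (0ℤ , 1ℤ) ≡ v →
           c ∈ A → c +ᶜ u ∈ A → c +ᶜ v ∈ A → ⊥
  corner {c} o refl refl c∈A u∈A v∈A = no-V (placed o c ,
    at (0ℤ , 1ℤ) v∈A ∷ at (1ℤ , 0ℤ) u∈A ∷ subst A (sym origin↦c) c∈A ∷ [])
    where
    at : ∀ a → c +ᶜ orient o a ∈ A → orient o a +ᶜ c ∈ A
    at a = subst A (+ᶜ-comm c (orient o a))
    orient-origin : ∀ o → orient o origin ≡ origin
    orient-origin (false , 0ᶠ) = refl
    orient-origin (false , 1ᶠ) = refl
    orient-origin (false , 2ᶠ) = refl
    orient-origin (false , 3ᶠ) = refl
    orient-origin (true  , 0ᶠ) = refl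
    orient-origin (true  , 1ᶠ) = refl
    orient-origin (true  , 2ᶠ) = refl
    orient-origin (true  , 3ᶠ) = refl
    origin↦c : orient o origin +ᶜ c ≡ c
    origin↦c = trans (cong (_+ᶜ c) (orient-origin o)) (trans (+ᶜ-comm origin c) (+ᶜ-identityʳ c))

  flat-step : ∀ {c d} → Flat c → StepIn A c d → Flat d
  flat-step {c} {d} (y≡0 , next) (c∈A , d∈A , adj) with Adjacent⇒neighbour c d adj
  ... | here refl = trans (ℤₚ.+-identityʳ _) y≡0 , inj₂ (subst A (sym (+ᶜ-cancelʳ c (1ℤ , 0ℤ))) c∈A)
  ... | there (here refl) = trans (ℤₚ.+-identityʳ _) y≡0 , inj₁ (subst A (sym (+ᶜ-cancelʳ c (-1ℤ , 0ℤ))) c∈A)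
  ... | there (there (here refl)) = ⊥-elim
    ([ (λ r∈A → corner {c} (false , 0ᶠ) refl refl c∈A r∈A d∈A)
     , (λ l∈A → corner {c} (true  , 2ᶠ) refl refl c∈A l∈A d∈A) ]′ next)
  ... | there (there (there (here refl))) = ⊥-elim
    ([ (λ r∈A → corner {c} (true  , 0ᶠ) refl refl c∈A r∈A d∈A)
     , (λ l∈A → corner {c} (false , 2ᶠ) refl refl c∈A l∈A d∈A) ]′ next)

  flat-path : ∀ {c d} → Flat c → Star (StepIn A) c d → Flat d
  flat-path flat ε             = flat
  flat-path flat (step ◅ path) = flat-path (flat-step flat step) path

nonNegative⇒∈S∞ : ∀ {x} → 0ℤ ℤ.≤ x → (x , 0ℤ) ∈ S∞-cells
nonNegative⇒∈S∞ {+ n} _ = n , refl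

-- Small shapes below a polyomino, and straight polyominoes

module Classical (em : ExcludedMiddle (lsuc 0ℓ)) where

  em₀ : ExcludedMiddle 0ℓ
  em₀ = map′ lower lift em

  -- If `P` has a cell outside the copy of the shape, a path to it leaves the copy through a
  -- boundary cell, which completes a member of `𝒬`. Otherwise `P` lies inside the copy.
  grow : ∀ {x X 𝒬} → Extends 𝒬 (x ∷ X) → ∀ P → x ∷ X ˢ⊑ cells P →
         P ⊑ˢ x ∷ X ⊎ Any (_ˢ⊑ cells P) 𝒬
  grow {x} {X} {𝒬} ext P (g , x∈ ∷ X⊆) with em₀ {∃[ d ] (d ∈ cells (preimage g P) × d ∉ˡ x ∷ X)}
  ... | yes (d , d∈ , d∉) =
    let (e , e∈∂ , e∈) = exit (x ∷ X) (here refl) d∉ (connected (preimage g P) {x} {d} x∈ d∈) in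
    inj₂ (Any.map (λ {Q} Q⊑ → ˢ⊑ˢ-trans {Q} {e ∷ x ∷ X} {cells P} Q⊑ (g , e∈ ∷ x∈ ∷ X⊆))
                  (All.lookup ext e∈∂))
  ... | no ∄d = inj₁ (g ⁻¹ , λ {c} c∈P → decidable-stable (_ ∈? _) λ c∉ →
    ∄d (apply (g ⁻¹) c , subst (cells P) (sym (apply-⁻¹ʳ g c)) c∈P , c∉))

  S₁ˢ⊑ : ∀ P → S₁ ˢ⊑ cells P
  S₁ˢ⊑ P = let (c , c∈P) = nonempty P in
    shifting c , subst (cells P) (sym (trans (+ᶜ-comm origin c) (+ᶜ-identityʳ c))) c∈P ∷ []

  -- Two rounds of growth: a cell extends to a domino, a domino to `S₃` or `V`.
  straight-or-V : ∀ P → P ⊑ˢ S₂ ⊎ S₃ ˢ⊑ cells P ⊎ V ˢ⊑ cells P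
  straight-or-V P with grow (from-yes (extends? (S₂ ∷ []) S₁)) P (S₁ˢ⊑ P)
  ... | inj₁ P⊑ = inj₁ (⊑ˢ-mono {P} P⊑ (from-yes (S₁ ˢ⊑ˢ? S₂)))
  ... | inj₂ (here S₂⊑) with grow (from-yes (extends? (S₃ ∷ V ∷ []) S₂)) P S₂⊑
  ...   | inj₁ P⊑                 = inj₁ P⊑
  ...   | inj₂ (here S₃⊑)         = inj₂ (inj₁ S₃⊑)
  ...   | inj₂ (there (here V⊑))  = inj₂ (inj₂ V⊑)

  tetromino-below : ∀ P → P ⊑ˢ V ⊎ P ⊑ˢ S₃ ⊎ Any (_ˢ⊑ cells P) tetrominoes
  tetromino-below P with straight-or-V P
  ... | inj₁ P⊑         = inj₁ (⊑ˢ-mono {P} P⊑ (from-yes (S₂ ˢ⊑ˢ? V)))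
  ... | inj₂ (inj₁ S₃⊑) = inj₂ (grow (from-yes (extends? tetrominoes S₃)) P S₃⊑)
  ... | inj₂ (inj₂ V⊑)  = [ inj₁ , inj₂ ∘ inj₂ ]′ (grow (from-yes (extends? tetrominoes V)) P V⊑)

  -- One cell added to `V` yields `T`, `L`, `O` or `S`, and the first two contain `S₃`.
  S₃-free : ∀ P → P ⊑ˢ V ⊎ Any (_ˢ⊑ cells P) (S₃ ∷ O ∷ S ∷ [])
  S₃-free P with straight-or-V P
  ... | inj₁ P⊑         = inj₁ (⊑ˢ-mono {P} P⊑ (from-yes (S₂ ˢ⊑ˢ? V)))
  ... | inj₂ (inj₁ S₃⊑) = inj₂ (here S₃⊑)
  ... | inj₂ (inj₂ V⊑)  = grow (from-yes (extends? (S₃ ∷ O ∷ S ∷ []) V)) P V⊑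

  -- Any cell added beside the square completes a row of three.
  without-O : ∀ P → ¬ P ⊑ˢ V → ¬ P ⊑ˢ O → Any (_ˢ⊑ cells P) (S₃ ∷ S ∷ [])
  without-O P P⋢V P⋢O with S₃-free P
  ... | inj₁ P⊑                         = contradiction P⊑ P⋢V
  ... | inj₂ (here S₃⊑)                 = here S₃⊑
  ... | inj₂ (there (there (here S⊑)))  = there (here S⊑)
  ... | inj₂ (there (here O⊑)) with grow (from-yes (extends? (S₃ ∷ []) O)) P O⊑
  ...   | inj₁ P⊑          = contradiction P⊑ P⋢O
  ...   | inj₂ (here S₃⊑)  = here S₃⊑

  -- A cell added to the skew tetromino completes a row of three, a square or the staircase `W`.
  without-S : ∀ P → ¬ P ⊑ˢ V → ¬ P ⊑ˢ S → Any (_ˢ⊑ cells P) (S₃ ∷ O ∷ W ∷ [])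
  without-S P P⋢V P⋢S with S₃-free P
  ... | inj₁ P⊑                         = contradiction P⊑ P⋢V
  ... | inj₂ (here S₃⊑)                 = here S₃⊑
  ... | inj₂ (there (here O⊑))          = there (here O⊑)
  ... | inj₂ (there (there (here S⊑))) with grow (from-yes (extends? (S₃ ∷ O ∷ W ∷ []) S)) P S⊑
  ...   | inj₁ P⊑  = contradiction P⊑ P⋢S
  ...   | inj₂ Q⊑  = Q⊑

  -- A polyomino without a corner lies in one row. If the row is bounded on one side, a translation,
  -- after a half turn when the bound is on the right, carries it into `S∞`; if it is bounded on
  -- neither side, connectedness fills the row.
  straight : ∀ P → ¬ V ˢ⊑ cells P → P ⊑ S∞ ⊎ cells P ≅ᶜ TwoEndedLine
  straight P no-V with straight-or-V P
  ... | inj₁ P⊑S₂ = inj₁ (⊑ˢ-ˢ⊑-trans {P} {S₂} {S∞} P⊑S₂ (identity , (1 , refl) ∷ (0 , refl) ∷ []))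
  ... | inj₂ (inj₂ V⊑) = contradiction V⊑ no-V
  ... | inj₂ (inj₁ (g , 2∈ ∷ 1∈ ∷ 0∈ ∷ [])) = cases
    where
    A = preimage g P
    flat : ∀ {c} → c ∈ cells A → proj₂ c ≡ 0ℤ
    flat {c} c∈A = proj₁ (flat-path no-V-in-A {d = c} (refl , inj₁ 1∈) (connected A {origin} {c} 0∈ c∈A))
      where
      no-V-in-A : ¬ V ˢ⊑ cells A
      no-V-in-A V⊑A = no-V (ˢ⊑-trans {V} {A} {P} V⊑A (≅⇒⊑ {A} {P} (preimage-≅ g P)))
    via : ∀ h → (∀ {c} → c ∈ cells A → apply h c ∈ S∞-cells) → P ⊑ S∞
    via h A⊆ = ⊑-trans {P} {A} {S∞} (≅⇒⊑ {P} {A} (≅-sym {A} {P} (preimage-≅ g P))) (h , λ {c} → A⊆ {c})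

    both-ends : (∀ x → ∃[ c ] (c ∈ cells A × proj₁ c ℤ.≤ x)) →
                (∀ x → ∃[ c ] (c ∈ cells A × x ℤ.≤ proj₁ c)) → cells P ≅ᶜ TwoEndedLine
    both-ends left right = g ⁻¹ , λ c → mk⇔
      (λ c∈P → flat {apply (g ⁻¹) c} (subst (cells P) (sym (apply-⁻¹ʳ g c)) c∈P))
      (λ y≡0 → subst (cells P) (apply-⁻¹ʳ g c) (onLine (apply (g ⁻¹) c) y≡0))
      where
      onLine : ∀ d → proj₂ d ≡ 0ℤ → d ∈ cells A
      onLine (x , _) refl = let (a , a∈A , a≤x) = left x ; (b , b∈A , x≤b) = right x in
        crossing x (λ {e} → flat {e}) (connected A {a} {b} a∈A b∈A) b∈A a≤x x≤b

    cases : P ⊑ S∞ ⊎ cells P ≅ᶜ TwoEndedLine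
    cases with em₀ {∃[ x ] (∀ {c} → c ∈ cells A → x ℤ.≤ proj₁ c)}
    ... | yes (x , x≤) = inj₁ (via (shifting (ℤ.- x , 0ℤ)) λ {c} c∈A →
      subst (_∈ S∞-cells) (cong (proj₁ c ℤ.- x ,_) (sym (trans (ℤₚ.+-identityʳ _) (flat {c} c∈A))))
        (nonNegative⇒∈S∞ (ℤₚ.i≤j⇒0≤j-i (x≤ {c} c∈A))))
    ... | no ∄left with em₀ {∃[ x ] (∀ {c} → c ∈ cells A → proj₁ c ℤ.≤ x)}
    ...   | yes (x , ≤x) = inj₁ (via (placed (false , 2ᶠ) (x , 0ℤ)) λ {c} c∈A →
      subst (_∈ S∞-cells)
        (cong₂ _,_ (ℤₚ.+-comm x _) (sym (trans (ℤₚ.+-identityʳ _) (cong ℤ.-_ (flat {c} c∈A)))))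
        (nonNegative⇒∈S∞ (ℤₚ.i≤j⇒0≤j-i (≤x {c} c∈A))))
    ...   | no ∄right = inj₂ (both-ends
      (λ x → decidable-stable em₀ λ ∄ → ∄left (x , λ {c} c∈A → ℤₚ.<⇒≤ (ℤₚ.≰⇒> λ c≤x → ∄ (c , c∈A , c≤x))))
      (λ x → decidable-stable em₀ λ ∄ → ∄right (x , λ {c} c∈A → ℤₚ.<⇒≤ (ℤₚ.≰⇒> λ x≤c → ∄ (c , c∈A , x≤c)))))

-- The breaker

-- A sum rather than a maximum: it is at least each of its terms, which is enough for finding free
-- cells.
bound : List Cell → ℕ
bound []             = 0
bound ((x , _) ∷ cs) = ∣ x ∣ ℕ.+ bound cs

bound-≥ : ∀ {c cs} → c ∈ˡ cs → ∣ proj₁ c ∣ ℕ.≤ bound cs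
bound-≥ (here refl)                     = ℕₚ.m≤m+n _ _
bound-≥ {cs = (x , _) ∷ _} (there c∈cs) = ℕₚ.≤-trans (bound-≥ c∈cs) (ℕₚ.m≤n+m _ ∣ x ∣)

fresh : List Cell → Cell
fresh cs = + suc (bound cs) , 0ℤ

fresh-∉ : ∀ cs → fresh cs ∉ˡ cs
fresh-∉ cs fresh∈ = ℕₚ.<-irrefl refl (bound-≥ fresh∈)

-- The breaker has to mark some cell even if the wanted one is taken; she then spends a fresh one.
prefer : Cell → List Cell → Cell
prefer c used with c ∈? used
... | yes _ = fresh used
... | no  _ = c

prefer-∉ : ∀ c used → prefer c used ∉ˡ used
prefer-∉ c used with c ∈? used
... | yes _   = fresh-∉ used
... | no  c∉  = c∉

prefer-uses : ∀ c used → c ∈ˡ prefer c used ∷ used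
prefer-uses c used with c ∈? used
... | yes c∈ = there c∈
... | no  _  = here refl

makerCells⊆marked : ∀ {c} h → c ∈ˡ makerCells h → c ∈ˡ marked h
makerCells⊆marked (_ ∷ h) (here refl) = here refl
makerCells⊆marked (_ ∷ h) (there c∈)  = there (there (there (makerCells⊆marked h c∈)))

-- A graph on the board in which c has the neighbours c + partner i (colour c).
-- The colour of (x , y) is found by going x + slope y steps around a cycle.
record Paving : Set where
  field
    n                 : ℕ
    forward backward  : Fin n → Fin n
    forward-backward  : ∀ κ → forward (backward κ) ≡ κ
    backward-forward  : ∀ κ → backward (forward κ) ≡ κ
    start             : Fin n
    slope             : ℤ
    partner           : Fin 2 → Fin n → Cell

  -- The action of the integers on the colours generated by `forward`; `walk-+` is the action law.
  walk : Fin n → ℤ → Fin n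
  walk κ (+ zero)       = κ
  walk κ (+ suc m)      = forward (walk κ (+ m))
  walk κ -[1+ zero ]    = backward κ
  walk κ -[1+ suc m ]   = backward (walk κ -[1+ m ])

  walk-suc : ∀ κ i → walk κ (1ℤ ℤ.+ i) ≡ forward (walk κ i)
  walk-suc κ (+ m)          = refl
  walk-suc κ -[1+ zero ]    = sym (forward-backward κ)
  walk-suc κ -[1+ suc m ]   = sym (forward-backward (walk κ -[1+ m ]))

  walk-pred : ∀ κ i → walk κ (-1ℤ ℤ.+ i) ≡ backward (walk κ i)
  walk-pred κ (+ zero)    = refl
  walk-pred κ (+ suc m)   = sym (backward-forward (walk κ (+ m)))
  walk-pred κ -[1+ m ]    = refl

  walk-+ : ∀ κ i j → walk κ (i ℤ.+ j) ≡ walk (walk κ j) i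
  walk-+ κ (+ zero)     j = cong (walk κ) (ℤₚ.+-identityˡ j)
  walk-+ κ (+ suc m)    j = trans (cong (walk κ) (ℤₚ.+-assoc 1ℤ (+ m) j))
    (trans (walk-suc κ (+ m ℤ.+ j)) (cong forward (walk-+ κ (+ m) j)))
  walk-+ κ -[1+ zero ]  j = walk-pred κ j
  walk-+ κ -[1+ suc m ] j = trans (cong (walk κ) (ℤₚ.+-assoc -1ℤ -[1+ m ] j))
    (trans (walk-pred κ (-[1+ m ] ℤ.+ j)) (cong backward (walk-+ κ -[1+ m ] j)))

  height : Cell → ℤ
  height (x , y) = x ℤ.+ slope ℤ.* y

  height-+ : ∀ c d → height (c +ᶜ d) ≡ height c ℤ.+ height d
  height-+ (x , y) (x′ , y′) = begin
    x ℤ.+ x′ ℤ.+ slope ℤ.* (y ℤ.+ y′)             ≡⟨ cong (λ z → x ℤ.+ x′ ℤ.+ z) (ℤₚ.*-distribˡ-+ slope y y′) ⟩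
    x ℤ.+ x′ ℤ.+ (slope ℤ.* y ℤ.+ slope ℤ.* y′)   ≡⟨ interchange x x′ (slope ℤ.* y) (slope ℤ.* y′) ⟩
    x ℤ.+ slope ℤ.* y ℤ.+ (x′ ℤ.+ slope ℤ.* y′)   ∎
    where open ≡-Reasoning

  colour : Cell → Fin n
  colour c = walk start (height c)

  -- The colours of a translated shape depend on the shift only through its colour. Hence properties
  -- of the whole infinite graph reduce to checks over finitely many colours.
  colour-+ : ∀ c d → colour (c +ᶜ d) ≡ walk (colour d) (height c)
  colour-+ c d = trans (cong (walk start) (height-+ c d)) (walk-+ start (height c) (height d))

  mate : Fin 2 → Cell → Cell
  mate i c = c +ᶜ partner i (colour c)

  -- The argument of `partner j` is the colour of the neighbour reached from a cell of colour `κ`;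
  -- some partner there leads back, so the graph is undirected.
  Symmetric : Set
  Symmetric = ∀ κ i → ∃[ j ] partner j (walk κ (height (partner i κ))) ≡ -ᶜ partner i κ

  symmetric? : Dec Symmetric
  symmetric? = allFin? λ κ → allFin? λ i → anyFin? λ j → _ ≟ᶜ _

  Loopless : Set
  Loopless = ∀ κ i → partner i κ ≢ origin

  loopless? : Dec Loopless
  loopless? = allFin? λ κ → allFin? λ i → ¬? (_ ≟ᶜ _)

  -- Every copy of `X` contains both ends of an edge. Here `κ` is the colour of the shift, and
  -- `walk κ (height (orient o a))` that of the image of `a`.
  Kills : Shape → Set
  Kills X = ∀ o κ → Any (λ a → Any (λ b → ∃[ i ]
    orient o b ≡ orient o a +ᶜ partner i (walk κ (height (orient o a)))) X) X

  kills? : ∀ X → Dec (Kills X)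
  kills? X = allOrientations? λ o → allFin? λ κ → any? (λ a → any? (λ b → anyFin? λ i → _ ≟ᶜ _) X) X

  mate-symmetric : Symmetric → ∀ i c → ∃[ j ] mate j (mate i c) ≡ c
  mate-symmetric symmetric i c = let (j , eq) = symmetric (colour c) i ; δ = partner i (colour c) in
    j , trans (cong (λ κ → c +ᶜ δ +ᶜ partner j κ) (trans (cong colour (+ᶜ-comm c δ)) (colour-+ δ c)))
          (trans (cong (c +ᶜ δ +ᶜ_) eq) (+ᶜ-cancelʳ c δ))

  mate-irreflexive : Loopless → ∀ i c → c ≢ mate i c
  mate-irreflexive loopless i c c≡ = loopless (colour c) i (trans (sym (+ᶜ-cancelʳ δ c))
    (trans (cong (_+ᶜ -ᶜ c) (trans (+ᶜ-comm δ c) (sym c≡))) (+ᶜ-inverseʳ c)))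
    where δ = partner i (colour c)

  killed : ∀ {X A} → Kills X → X ˢ⊑ A → ∃[ c ] ∃[ i ] (c ∈ A × mate i c ∈ A)
  killed {X} {A} kills (g , X⊆A) =
    let (a , a∈X , any)    = find (kills o (colour s))
        (b , b∈X , i , eq) = find any
    in apply g a , i , All.lookup X⊆A a∈X , subst A (edge (orient o a) i eq) (All.lookup X⊆A b∈X)
    where
    open ≡-Reasoning
    o = orientation g
    s = shift g
    edge : ∀ a i {b} → b ≡ a +ᶜ partner i (walk (colour s) (height a)) → b +ᶜ s ≡ mate i (a +ᶜ s)
    edge a i {b} eq = begin
      b +ᶜ s                                   ≡⟨ cong (_+ᶜ s) eq ⟩
      a +ᶜ δ +ᶜ s                              ≡⟨ +ᶜ-assoc a δ s ⟩
      a +ᶜ (δ +ᶜ s)                            ≡⟨ cong (a +ᶜ_) (+ᶜ-comm δ s) ⟩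
      a +ᶜ (s +ᶜ δ)                            ≡⟨ +ᶜ-assoc a s δ ⟨
      a +ᶜ s +ᶜ δ                              ≡⟨ cong (λ κ → a +ᶜ s +ᶜ partner i κ) (colour-+ a s) ⟨
      a +ᶜ s +ᶜ partner i (colour (a +ᶜ s))    ∎
      where δ = partner i (walk (colour s) (height a))

  breaker : BreakerStrategy
  breaker = record
    { reply₁   = λ h c → prefer (mate 0ᶠ c) (c ∷ marked h)
    ; reply₂   = λ h c → prefer (mate 1ᶠ c) (prefer (mate 0ᶠ c) (c ∷ marked h) ∷ c ∷ marked h)
    ; distinct = λ h c eq → prefer-∉ (mate 1ᶠ c) _ (here (sym eq))
    ; legal₁   = λ h c → prefer-∉ (mate 0ᶠ c) _
    ; legal₂   = λ h c → prefer-∉ (mate 1ᶠ c) _ ∘ there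
    }

  module _ (symmetric : Symmetric) (loopless : Loopless) (σ : MakerStrategy) where

    open MakerStrategy σ
    open BreakerStrategy breaker

    private
      after : ℕ → History
      after = play σ breaker

    mates-marked : ∀ m i {c} → c ∈ˡ makerCells (after m) → mate i c ∈ˡ marked (after m)
    mates-marked (suc m) i (there c∈) = there (there (there (mates-marked m i c∈)))
    mates-marked (suc m) 0ᶠ {c} (here refl) with prefer-uses (mate 0ᶠ c) (c ∷ marked (after m))
    ... | here eq          = there (here eq)
    ... | there (here eq)  = here eq
    ... | there (there p)  = there (there (there p))
    mates-marked (suc m) 1ᶠ {c} (here refl)
      with prefer-uses (mate 1ᶠ c) (reply₁ (after m) c ∷ c ∷ marked (after m))
    ... | here eq                  = there (there (here eq))
    ... | there (here eq)          = there (here eq)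
    ... | there (there (here eq))  = here eq
    ... | there (there (there p))  = there (there (there p))

    -- When the maker takes one end of an edge, the breaker makes sure that the other is marked in
    -- the same round. So he cannot take it later; symmetry makes this apply whichever end comes
    -- first.
    mates-apart : ∀ m i {c} → c ∈ˡ makerCells (after m) → mate i c ∉ˡ makerCells (after m)
    mates-apart (suc m) i {c} (here refl) (here eq)  = mate-irreflexive loopless i c (sym eq)
    mates-apart (suc m) i {c} (here refl) (there d∈) = let (j , eq) = mate-symmetric symmetric i c in
      legal (after m) (subst (_∈ˡ marked (after m)) eq (mates-marked m j d∈))
    mates-apart (suc m) i (there c∈) (here eq)  =
      legal (after m) (subst (_∈ˡ marked (after m)) eq (mates-marked m i c∈))
    mates-apart (suc m) i (there c∈) (there d∈) = mates-apart m i c∈ d∈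

  breaker-wins : Symmetric → Loopless → ∀ {𝒬 𝒮} → All Kills 𝒬 →
                 (∀ {P} → P ∈ 𝒮 → Any (_ˢ⊑ cells P) 𝒬) → ¬ MakerWins 𝒮
  breaker-wins symmetric loopless {𝒬} kills below (σ , wins) =
    let (m , P , P∈𝒮 , g , P⊆) = wins breaker
        (Q , Q∈𝒬 , h , Q⊆P)    = find (below P∈𝒮)
        (c , i , c∈ , d∈) = killed {Q} {_∈ˡ makerCells (play σ breaker m)} (All.lookup kills Q∈𝒬)
          (g ∙ h , All.map (λ {c} c∈P → subst (_∈ˡ _) (sym (apply-∙ g h c)) (P⊆ c∈P)) Q⊆P)
    in mates-apart symmetric loopless σ m i c∈ d∈

-- Five periodic graphs

four : (Fin 4 → Cell × Cell) → ℤ → Paving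
four partners slope = record
  { n = 4 ; forward = next ; backward = next ∘ next ∘ next
  ; forward-backward = cycle ; backward-forward = cycle
  ; start = 0ᶠ ; slope = slope
  ; partner = λ where
      0ᶠ κ → proj₁ (partners κ)
      1ᶠ κ → proj₂ (partners κ)
  }
  where
  cycle : ∀ κ → next (next (next (next κ))) ≡ κ
  cycle 0ᶠ = refl
  cycle 1ᶠ = refl
  cycle 2ᶠ = refl
  cycle 3ᶠ = refl

→ᶜ ←ᶜ ↑ᶜ ↓ᶜ : Cell
→ᶜ = 1ℤ , 0ℤ
←ᶜ = -1ℤ , 0ℤ
↑ᶜ = 0ℤ , 1ℤ
↓ᶜ = 0ℤ , -1ℤ

-- All colours have the same partners: the edges are the vertical ones, the components the columns.
lines : Paving
lines = four (λ _ → ↑ᶜ , ↓ᶜ) 0ℤ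

-- The colour is x - 2 y modulo 4. Each component is an infinite path in a strip of two columns,
-- which crosses every row and climbs alternately on the left and on the right.
snakes : Paving
snakes = four (λ where
  0ᶠ → ←ᶜ , ↓ᶜ
  1ᶠ → →ᶜ , ↓ᶜ
  2ᶠ → ←ᶜ , ↑ᶜ
  3ᶠ → →ᶜ , ↑ᶜ) (ℤ.- + 2)

-- The components are 4-cycles on 2 by 2 squares, which tile the board in strips of two columns,
-- neighbouring strips being shifted by one row.
bricks : Paving
bricks = four (λ where
  0ᶠ → ←ᶜ , ↓ᶜ
  1ᶠ → →ᶜ , ↑ᶜ
  2ᶠ → ←ᶜ , ↑ᶜ
  3ᶠ → →ᶜ , ↓ᶜ) (ℤ.- + 2)

-- The colour is x - y modulo 4. The components are infinite staircases that turn after every two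
-- edges.
stairs₂ : Paving
stairs₂ = four (λ where
  0ᶠ → →ᶜ , ↑ᶜ
  1ᶠ → ←ᶜ , →ᶜ
  2ᶠ → ←ᶜ , ↓ᶜ
  3ᶠ → ↑ᶜ , ↓ᶜ) -1ℤ

-- The colour is x - y modulo 3. Colours 0 and 1 form staircases that turn at every cell; the cells
-- of colour 2 between them are joined along diagonals.
stairs₁ : Paving
stairs₁ = record
  { n = 3 ; forward = f ; backward = f ∘ f
  ; forward-backward = cycle ; backward-forward = cycle
  ; start = 0ᶠ ; slope = -1ℤ
  ; partner = λ where
      0ᶠ 0ᶠ → →ᶜ
      1ᶠ 0ᶠ → ↓ᶜ
      0ᶠ 1ᶠ → ←ᶜ
      1ᶠ 1ᶠ → ↑ᶜ
      0ᶠ 2ᶠ → 1ℤ , 1ℤ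
      1ᶠ 2ᶠ → -1ℤ , -1ℤ
  }
  where
  f : Fin 3 → Fin 3
  f 0ᶠ = 1ᶠ
  f 1ᶠ = 2ᶠ
  f 2ᶠ = 0ᶠ
  cycle : ∀ κ → f (f (f κ)) ≡ κ
  cycle 0ᶠ = refl
  cycle 1ᶠ = refl
  cycle 2ᶠ = refl

Defeats : Paving → List Shape → Set
Defeats π 𝒬 = Paving.Symmetric π × Paving.Loopless π × All (Paving.Kills π) 𝒬

defeats? : ∀ π 𝒬 → Dec (Defeats π 𝒬)
defeats? π 𝒬 = Paving.symmetric? π ×-dec Paving.loopless? π ×-dec all? (Paving.kills? π) 𝒬

-- The maker

module _ {a} {A : Set a} (_≟_ : DecidableEquality A) where

  -- Deleting the head of `xs` from `ys` shortens `ys` but keeps the rest of `xs`, whose elements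
  -- differ from the head.
  Unique-⊆⇒length-≤ : ∀ {xs ys : List A} → Unique xs → (∀ {x} → x ∈ˡ xs → x ∈ˡ ys) → length xs ℕ.≤ length ys
  Unique-⊆⇒length-≤ {[]} _ _ = z≤n
  Unique-⊆⇒length-≤ {x ∷ xs} {ys} (x∉xs ∷ unique) ⊆ys = ℕₚ.≤-trans
    (s≤s (Unique-⊆⇒length-≤ unique λ y∈xs → ∈-filter⁺ ≢x? (⊆ys (there y∈xs)) (All.lookup x∉xs y∈xs ∘ sym)))
    (filter-notAll ≢x? ys (Any.map (λ x≡y y≢x → y≢x (sym x≡y)) (⊆ys (here refl))))
    where ≢x? = λ y → ¬? (y ≟ x)

  escape : ∀ {xs ys : List A} → Unique xs → length ys ℕ.< length xs → ∃[ x ] (x ∈ˡ xs × x ∉ˡ ys)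
  escape {xs} {ys} unique ∣ys∣<∣xs∣ with any? (λ x → ¬? (DecMembership._∈?_ _≟_ x ys)) xs
  ... | yes some = find some
  ... | no  none = contradiction (Unique-⊆⇒length-≤ unique λ x∈xs → decidable-stable
    (DecMembership._∈?_ _≟_ _ ys) (All.lookup (¬Any⇒All¬ xs none) x∈xs)) (ℕₚ.<⇒≱ ∣ys∣<∣xs∣)

length-marked : ∀ h → length (marked h) ≡ 3 ℕ.* length h
length-marked []      = refl
length-marked (_ ∷ h) = trans (cong (3 ℕ.+_) (length-marked h)) (sym (ℕₚ.*-suc 3 (length h)))

surroundings : Shape → Shape
surroundings X = deduplicate _≟ᶜ_ (boundary X ++ X)

-- After n rounds some cell around X is free, and wherever it is, adding it
-- to X completes one of 𝒬.
Crowded : ℕ → List Shape → Shape → Set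
Crowded n 𝒬 X = Extends 𝒬 X × 3 ℕ.* n ℕ.< length (surroundings X)

crowded? : ∀ n 𝒬 X → Dec (Crowded n 𝒬 X)
crowded? n 𝒬 X = extends? 𝒬 X ×-dec (_ ℕ.<? _)

-- Forcing trees and counting arguments

module _ (𝒮 : PolyominoSet) where

  -- A winning strategy from `h` as a well-founded tree. It branches over all pairs of replies,
  -- illegal ones included, so no legality of the breaker has to be tracked.
  data Force (h : History) : Set₁ where
    won    : Achieved 𝒮 h → Force h
    forced : ∀ c → c ∉ˡ marked h → (∀ d e → Force ((c , d , e) ∷ h)) → Force h

  module _ (root : Force []) where

    advance : ∀ {h} → Maybe (Force h) → ∀ c d e → Maybe (Force ((c , d , e) ∷ h))
    advance (just (forced c′ _ continue)) c d e with c′ ≟ᶜ c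
    ... | yes refl = just (continue d e)
    ... | no  _    = nothing
    advance _ _ _ _ = nothing

    -- nothing: the play has left the tree or reached a leaf
    state : ∀ h → Maybe (Force h)
    state []                = just root
    state ((c , d , e) ∷ h) = advance (state h) c d e

    -- A strategy must answer every history legally, so a free cell is supplied off the tree.
    response : ∀ {h} → Maybe (Force h) → ∃[ c ] c ∉ˡ marked h
    response     (just (forced c c∉ _)) = c , c∉
    response {h} _                      = fresh (marked h) , fresh-∉ (marked h)

    follower : MakerStrategy
    follower = record
      { move  = λ h → proj₁ (response (state h))
      ; legal = λ h → proj₂ (response (state h))
      }

    advance-forced : ∀ {h} c c∉ continue d e →
                     advance {h} (just (forced c c∉ continue)) c d e ≡ just (continue d e)
    advance-forced c c∉ continue d e with c ≟ᶜ c
    ... | yes refl = refl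
    ... | no  c≢c  = contradiction refl c≢c

    -- Induction on the tree: the play stays on it, and a leaf is reached after finitely many
    -- rounds.
    follows : ∀ β m {h} (t : Force h) → play follower β m ≡ h → state h ≡ just t →
              ∃[ n ] Achieved 𝒮 (play follower β n)
    follows β m (won achieved) eq _ = m , subst (Achieved 𝒮) (sym eq) achieved
    follows β m {h} (forced c c∉ continue) refl eq = follows β (suc m) (continue (reply₁ h c) (reply₂ h c))
      (cong (λ s → let c = proj₁ (response s) in (c , reply₁ h c , reply₂ h c) ∷ h) eq)
      (trans (cong (λ s → advance s c _ _) eq) (advance-forced c c∉ continue _ _))
      where open BreakerStrategy β

  Force⇒MakerWins : Force [] → MakerWins 𝒮
  Force⇒MakerWins root = follower root , λ β → follows root β 0 root refl refl

  Has : Shape → Set₁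
  Has X = ∃[ P ] (P ∈ 𝒮 × P ⊑ˢ X)

  -- Of the position only the number of rounds and a copy of `X` owned by the maker are known. The
  -- former limits the number of marked cells, which is all that counting needs.
  Forces : ℕ → Shape → Set₁
  Forces n X = ∀ h → length h ≡ n → X ˢ⊑ (_∈ˡ makerCells h) → Force h

  Has⇒Forces : ∀ {n X} → Has X → Forces n X
  Has⇒Forces (P , P∈𝒮 , g , P⊆X) h _ (k , X⊆) = won (P , P∈𝒮 , k ∙ g ,
    λ {c} c∈P → subst (_∈ˡ makerCells h) (sym (apply-∙ k g c)) (All.lookup X⊆ (P⊆X c∈P)))

  Forces-mono : ∀ {n X Y} → X ˢ⊑ˢ Y → Forces n X → Forces n Y
  Forces-mono {X = X} X⊑Y forces h len Y⊑ = forces h len (ˢ⊑ˢ-trans {X} {A = _∈ˡ makerCells h} X⊑Y Y⊑)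

  -- Only 3 n cells are marked, so some cell of Z is free; it cannot belong to X.
  advance-by-counting : ∀ {n X} Z → Unique Z → 3 ℕ.* n ℕ.< length Z →
    (∀ {z} → z ∈ˡ Z → z ∈ˡ X ⊎ Forces (suc n) (z ∷ X)) → Forces n X
  advance-by-counting {n} {X} Z unique 3n<∣Z∣ options h refl (g , X⊆)
    with escape _≟ᶜ_ (Uniqueₚ.map⁺ (apply-injective g) unique)
           (subst₂ ℕ._<_ (sym (length-marked h)) (sym (length-map (apply g) Z)) 3n<∣Z∣)
  ... | c , c∈gZ , c-free with ∈-map⁻ (apply g) c∈gZ
  ...   | z , z∈Z , refl with options z∈Z
  ...     | inj₁ z∈X    = contradiction (makerCells⊆marked h (All.lookup X⊆ z∈X)) c-free
  ...     | inj₂ forces = forced (apply g z) c-free λ d e →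
    forces ((apply g z , d , e) ∷ h) refl (g , here refl ∷ All.map there X⊆)

  advance-by-boundary : ∀ {n X 𝒬} → Crowded n 𝒬 X → All (Forces (suc n)) 𝒬 → Forces n X
  advance-by-boundary {n} {X} (extends , 3n<) forces =
    advance-by-counting (surroundings X) (deduplicate-! _≟ᶜ_ (boundary X ++ X)) 3n< options
    where
    options : ∀ {z} → z ∈ˡ surroundings X → z ∈ˡ X ⊎ Forces (suc n) (z ∷ X)
    options z∈ with ∈-++⁻ (boundary X) (∈-deduplicate⁻ _≟ᶜ_ (boundary X ++ X) z∈)
    ... | inj₂ z∈X = inj₁ z∈X
    ... | inj₁ z∈∂ with find (All.lookup extends z∈∂)
    ...   | Q , Q∈𝒬 , Q⊑ = inj₂ (Forces-mono Q⊑ (All.lookup forces Q∈𝒬))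

  domino-suffices : Forces 2 S₂ → MakerWins 𝒮
  domino-suffices forces₂ = Force⇒MakerWins (forces₀ [] refl (identity , []))
    where
    forces₁ : Forces 1 S₁
    forces₁ = advance-by-boundary (from-yes (crowded? 1 (S₂ ∷ []) S₁)) (forces₂ ∷ [])
    forces₀ : Forces 0 []
    forces₀ = advance-by-counting S₁ ([] ∷ []) (s≤s z≤n) λ where (here refl) → inj₂ forces₁

  -- The counts suffice: a domino with its boundary has 8 cells against 6 marked ones, and a corner
  -- with its boundary has 10 against 9.
  S₃-O-S-win : Has S₃ → Has O → Has S → MakerWins 𝒮
  S₃-O-S-win has-S₃ has-O has-S = domino-suffices
    (advance-by-boundary (from-yes (crowded? 2 (S₃ ∷ V ∷ []) S₂)) (Has⇒Forces has-S₃ ∷ forces-V ∷ []))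
    where
    forces-V : Forces 3 V
    forces-V = advance-by-boundary (from-yes (crowded? 3 (S₃ ∷ O ∷ S ∷ []) V))
      (Has⇒Forces has-S₃ ∷ Has⇒Forces has-O ∷ Has⇒Forces has-S ∷ [])

-- Forcing a corner or a long line

line : ℕ → Shape
line zero    = []
line (suc m) = (+ m , 0ℤ) ∷ line m

∈-line : ∀ {i m} → i ℕ.< m → (+ i , 0ℤ) ∈ˡ line m
∈-line {i} {suc m} i<1+m with ℕₚ.m≤n⇒m<n∨m≡n (ℕₚ.≤-pred i<1+m)
... | inj₁ i<m  = there (∈-line i<m)
... | inj₂ refl = here refl

-- The line together with the rows on both sides of it. Its size is exactly the number of cells
-- marked after `m` rounds, so a single further cell exceeds that number.
strip : ℕ → Shape
strip zero    = []
strip (suc m) = (+ m , 1ℤ) ∷ (+ m , 0ℤ) ∷ (+ m , -1ℤ) ∷ strip m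

length-strip : ∀ m → length (strip m) ≡ 3 ℕ.* m
length-strip zero    = refl
length-strip (suc m) = trans (cong (3 ℕ.+_) (length-strip m)) (sym (ℕₚ.*-suc 3 m))

data InStrip (m : ℕ) : Cell → Set where
  over   : ∀ {i} → i ℕ.< m → InStrip m (+ i , 1ℤ)
  within : ∀ {i} → i ℕ.< m → InStrip m (+ i , 0ℤ)
  under  : ∀ {i} → i ℕ.< m → InStrip m (+ i , -1ℤ)

strip⇒InStrip : ∀ {m c} → c ∈ˡ strip m → InStrip m c
strip⇒InStrip {suc m} (here refl)                 = over ℕₚ.≤-refl
strip⇒InStrip {suc m} (there (here refl))         = within ℕₚ.≤-refl
strip⇒InStrip {suc m} (there (there (here refl))) = under ℕₚ.≤-refl
strip⇒InStrip {suc m} (there (there (there c∈))) with strip⇒InStrip c∈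
... | over i<m   = over (ℕₚ.m≤n⇒m≤1+n i<m)
... | within i<m = within (ℕₚ.m≤n⇒m≤1+n i<m)
... | under i<m  = under (ℕₚ.m≤n⇒m≤1+n i<m)

beyond-strip : ∀ {m y c} → c ∈ˡ strip m → (+ m , y) ≢ c
beyond-strip c∈ refl with strip⇒InStrip c∈
... | over i<m   = ℕₚ.<-irrefl refl i<m
... | within i<m = ℕₚ.<-irrefl refl i<m
... | under i<m  = ℕₚ.<-irrefl refl i<m

strip-unique : ∀ m → Unique (strip m)
strip-unique zero    = []
strip-unique (suc m) =
  ((λ ()) ∷ (λ ()) ∷ All.tabulate beyond-strip) ∷
  ((λ ()) ∷ All.tabulate beyond-strip) ∷
  All.tabulate beyond-strip ∷
  strip-unique m

-- At the left end the corner uses the next cell of the line, elsewhere the previous one.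
V-above : ∀ {i m} → i ℕ.< suc (suc m) → V ˢ⊑ˢ (+ i , 1ℤ) ∷ line (suc (suc m))
V-above {zero}  _   = identity , here refl ∷ there (∈-line (s≤s (s≤s z≤n))) ∷ there (∈-line (s≤s z≤n)) ∷ []
V-above {suc i} i<m = placed (true , 2ᶠ) (+ suc i , 0ℤ) ,
  here refl ∷ there (∈-line (ℕₚ.≤-trans (ℕₚ.n≤1+n _) i<m)) ∷ there (∈-line i<m) ∷ []

V-below : ∀ {i m} → i ℕ.< suc (suc m) → V ˢ⊑ˢ (+ i , -1ℤ) ∷ line (suc (suc m))
V-below {zero}  _   = placed (true , 0ᶠ) origin ,
  here refl ∷ there (∈-line (s≤s (s≤s z≤n))) ∷ there (∈-line (s≤s z≤n)) ∷ []
V-below {suc i} i<m = placed (false , 2ᶠ) (+ suc i , 0ℤ) ,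
  here refl ∷ there (∈-line (ℕₚ.≤-trans (ℕₚ.n≤1+n _) i<m)) ∷ there (∈-line i<m) ∷ []

module _ {𝒮 : PolyominoSet} (has-V : Has 𝒮 V) where

  -- If a cell beside the line is free, marking it completes V; if none is, the
  -- cell after the line is free.
  forces-line : ∀ j m → Has 𝒮 (line (2 ℕ.+ (j ℕ.+ m))) → Forces 𝒮 (2 ℕ.+ m) (line (2 ℕ.+ m))
  forces-line zero    m has-line = Has⇒Forces 𝒮 has-line
  forces-line (suc j) m has-line = advance-by-counting 𝒮 ((+ n , 0ℤ) ∷ strip n)
    (All.tabulate beyond-strip ∷ strip-unique n) (ℕₚ.≤-reflexive (cong suc (sym (length-strip n)))) options
    where
    n = 2 ℕ.+ m
    options : ∀ {z} → z ∈ˡ (+ n , 0ℤ) ∷ strip n → z ∈ˡ line n ⊎ Forces 𝒮 (suc n) (z ∷ line n)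
    options (here refl) = inj₂ (forces-line j (suc m)
      (subst (λ k → Has 𝒮 (line (2 ℕ.+ k))) (sym (ℕₚ.+-suc j m)) has-line))
    options (there z∈) with strip⇒InStrip z∈
    ... | within i<n = inj₁ (∈-line i<n)
    ... | over i<n   = inj₂ (Forces-mono 𝒮 (V-above i<n) (Has⇒Forces 𝒮 has-V))
    ... | under i<n  = inj₂ (Forces-mono 𝒮 (V-below i<n) (Has⇒Forces 𝒮 has-V))

  V-and-line-win : ∀ j → Has 𝒮 (line (2 ℕ.+ j)) → MakerWins 𝒮
  V-and-line-win j has-line = domino-suffices 𝒮
    (forces-line j 0 (subst (λ k → Has 𝒮 (line (2 ℕ.+ k))) (sym (ℕₚ.+-identityʳ j)) has-line))

  V-and-finite-line-win : (∃[ P ] (P ∈ 𝒮 × P ⊑ S∞ × Finite P)) → MakerWins 𝒮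
  V-and-finite-line-win (P , P∈𝒮 , (g , P⊆) , cs , P⊆cs) = V-and-line-win b (P , P∈𝒮 , g , inside)
    where
    -- No cell of the copy of `P` in `S∞` has a first coordinate above `b`, so the first `2 ℕ.+ b`
    -- cells contain the copy; the 2 is the domino from which the line is grown.
    b = bound (map (apply g) cs)
    inside : ∀ {c} → c ∈ cells P → apply g c ∈ˡ line (2 ℕ.+ b)
    inside {c} c∈P with apply g c | P⊆ c∈P | ∈-map⁺ (apply g) (P⊆cs c∈P)
    ... | _ | i , refl | c∈ = ∈-line (ℕₚ.m≤n⇒m≤1+n (s≤s (bound-≥ c∈)))

-- Winning and losing sets

infix 4 _≟ˢ_
_≟ˢ_ : DecidableEquality Shape
_≟ˢ_ = List-≡-dec _≟ᶜ_

-- A decidable certificate of connectedness: each cell touches one further down the list, so all are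
-- linked to the last cell.
Grown : Shape → Set
Grown []            = ⊥
Grown (c ∷ [])      = ⊤
Grown (c ∷ d ∷ X)   = Any (Adjacent c) (d ∷ X) × Grown (d ∷ X)

grown? : ∀ X → Dec (Grown X)
grown? []          = no λ ()
grown? (c ∷ [])    = yes tt
grown? (c ∷ d ∷ X) = any? (λ e → _ ℕ.≟ 1) (d ∷ X) ×-dec grown? (d ∷ X)

root : ∀ X → Grown X → Cell
root (c ∷ [])    _         = c
root (c ∷ d ∷ X) (_ , grown) = root (d ∷ X) grown

to-root : ∀ X (grown : Grown X) {c} → c ∈ˡ X → Star (StepIn (_∈ˡ X)) c (root X grown)
to-root (c ∷ [])    _             (here refl) = ε
to-root (c ∷ X@(_ ∷ _)) (_ , grown) (there c∈X) =
  Star.map (λ (a∈ , b∈ , adj) → there a∈ , there b∈ , adj) (to-root X grown c∈X)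
to-root (c ∷ X@(_ ∷ _)) (adj , grown) (here refl) = let (e , e∈X , c~e) = find adj in
  (here refl , there e∈X , c~e) ◅
  Star.map (λ (a∈ , b∈ , adj) → there a∈ , there b∈ , adj) (to-root X grown e∈X)

polyomino : ∀ X → Grown X → Polyomino
polyomino X grown .cells          = _∈ˡ X
polyomino X@(c ∷ _) grown .nonempty = c , here refl
polyomino X grown .connected      = connected-via (root X grown) (to-root X grown)

tetrominoes-unique : Unique tetrominoes
tetrominoes-unique = from-yes (unique? _≟ˢ_ tetrominoes)

others : Shape → List Shape
others Q = filter (λ X → ¬? (X ≟ˢ Q)) tetrominoes

Defeated : List Shape → Set
Defeated 𝒬 = ∃[ π ] Defeats π 𝒬

others-defeated : ∀ {Q} → Q ∈ˡ tetrominoes → Defeated (others Q)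
others-defeated (here refl)                                 =
  lines   , from-yes (defeats? lines   (others I))
others-defeated (there (here refl))                         =
  stairs₁ , from-yes (defeats? stairs₁ (others T))
others-defeated (there (there (here refl)))                 =
  snakes  , from-yes (defeats? snakes  (others O))
others-defeated (there (there (there (here refl))))         =
  bricks  , from-yes (defeats? bricks  (others S))
others-defeated (there (there (there (there (here refl))))) =
  stairs₂ , from-yes (defeats? stairs₂ (others L))

others-grown : ∀ {Q} → Q ∈ˡ tetrominoes → All Grown (others Q)
others-grown = All.lookup (from-yes (all? (λ Q → all? grown? (others Q)) tetrominoes))

V⊑T₂ : V ˢ⊑ T₂-cells
V⊑T₂ = shifting (1ℤ , 0ℤ) ,
  inj₂ refl ∷ inj₁ (2 , s≤s (s≤s (s≤s z≤n)) , refl) ∷ inj₁ (1 , s≤s (s≤s z≤n) , refl) ∷ []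

V⊑C : ∀ n → 2 ℕ.≤ n → V ˢ⊑ C-cells n
V⊑C n 2≤n = identity , inj₂ (inj₁ refl) ∷ inj₁ (1 , 2≤n , refl) ∷ inj₁ (0 , ℕₚ.<⇒≤ 2≤n , refl) ∷ []

V⊑Z : ∀ n → 2 ℕ.≤ n → V ˢ⊑ Z-cells n
V⊑Z n 2≤n = identity , inj₂ (inj₁ refl) ∷ inj₁ (1 , 2≤n , refl) ∷ inj₁ (0 , ℕₚ.<⇒≤ 2≤n , refl) ∷ []

S₃⊑ : ∀ n {A} → (∀ {c} → c ∈ S-cells (3 ℕ.+ n) → c ∈ A) → S₃ ˢ⊑ A
S₃⊑ n S⊆A = identity ,
  S⊆A (2 , s≤s (s≤s (s≤s z≤n)) , refl) ∷ S⊆A (1 , s≤s (s≤s z≤n) , refl) ∷ S⊆A (0 , s≤s z≤n , refl) ∷ []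

O⊑C₂ : O ˢ⊑ C-cells 2
O⊑C₂ = identity ,
  inj₂ (inj₂ refl) ∷ inj₂ (inj₁ refl) ∷ inj₁ (1 , s≤s (s≤s z≤n) , refl) ∷ inj₁ (0 , s≤s z≤n , refl) ∷ []

S⊑Z₂ : S ˢ⊑ Z-cells 2
S⊑Z₂ = identity ,
  inj₂ (inj₂ refl) ∷ inj₂ (inj₁ refl) ∷ inj₁ (1 , s≤s (s≤s z≤n) , refl) ∷ inj₁ (0 , s≤s z≤n , refl) ∷ []

-- The cells of `C 3`. The only tetromino inside it is `L`.
U : Shape
U = (+ 2 , 1ℤ) ∷ L

S⊆line : ∀ {n c} → c ∈ S-cells n → c ∈ˡ line n
S⊆line (i , i<n , refl) = ∈-line i<n

⊆⇒⊑ˢ : ∀ {P Q X} → (∀ {c} → c ∈ cells Q → c ∈ˡ X) → P ⊑ Q → P ⊑ˢ X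
⊆⇒⊑ˢ Q⊆X (g , P⊆Q) = g , Q⊆X ∘ P⊆Q

T₂⊆T : ∀ {c} → c ∈ T₂-cells → c ∈ˡ T
T₂⊆T (inj₁ c∈)   = there (S⊆line c∈)
T₂⊆T (inj₂ refl) = here refl

C₂⊆O : ∀ {c} → c ∈ C-cells 2 → c ∈ˡ O
C₂⊆O (inj₁ c∈)          = there (there (S⊆line c∈))
C₂⊆O (inj₂ (inj₁ refl)) = there (here refl)
C₂⊆O (inj₂ (inj₂ refl)) = here refl

Z₂⊆S : ∀ {c} → c ∈ Z-cells 2 → c ∈ˡ S
Z₂⊆S (inj₁ c∈)          = there (there (S⊆line c∈))
Z₂⊆S (inj₂ (inj₁ refl)) = there (here refl)
Z₂⊆S (inj₂ (inj₂ refl)) = here refl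

C₃⊆U : ∀ {c} → c ∈ C-cells 3 → c ∈ˡ U
C₃⊆U (inj₁ c∈)          = there (there (S⊆line c∈))
C₃⊆U (inj₂ (inj₁ refl)) = there (here refl)
C₃⊆U (inj₂ (inj₂ refl)) = here refl

none-below : ∀ {𝒬 P Y} → All (λ X → ¬ X ˢ⊑ˢ Y) 𝒬 → P ⊑ˢ Y → ¬ Any (_ˢ⊑ cells P) 𝒬
none-below {P = P} {Y} none P⊑Y any = let (X , X∈𝒬 , X⊑P) = find any in
  All.lookup none X∈𝒬 (ˢ⊑-⊑ˢ-trans {X} {P} {Y} X⊑P P⊑Y)

-- As `S∞` is infinite, containment in it is not settled by evaluation. Instead, the graph `lines`
-- shows that every copy of a tetromino other than `I` has two vertically adjacent cells, and `S∞`
-- has none.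
none-in-S∞ : ∀ {P} → P ⊑ S∞ → ¬ Any (_ˢ⊑ cells P) (others I)
none-in-S∞ {P} P⊑S∞ any = let (X , X∈ , X⊑P) = find any in
  no-vertical-edge (Paving.killed lines {X} {S∞-cells} (All.lookup kills X∈) (ˢ⊑-trans {X} {P} {S∞} X⊑P P⊑S∞))
  where
  kills : All (Paving.Kills lines) (others I)
  kills = from-yes (all? (Paving.kills? lines) (others I))
  no-vertical-edge : ¬ (∃[ c ] ∃[ i ] (c ∈ S∞-cells × Paving.mate lines i c ∈ S∞-cells))
  no-vertical-edge (_ , 0ᶠ , (_ , refl) , (_ , ()))
  no-vertical-edge (_ , 1ᶠ , (_ , refl) , (_ , ()))

-- The criterion and its equivalence with both conditions

module Characterisation (em : ExcludedMiddle (lsuc 0ℓ)) where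
  open Classical em

  -- Choosing by the order of the list makes the choice depend only on the congruence class.
  -- Counting members up to congruence and the field `respects` both rely on this.
  first-below : List Shape → Polyomino → Shape
  first-below []      P = []
  first-below (X ∷ 𝒬) P with em₀ {X ˢ⊑ cells P}
  ... | yes _ = X
  ... | no  _ = first-below 𝒬 P

  first-below-correct : ∀ {𝒬 P} → Any (_ˢ⊑ cells P) 𝒬 → first-below 𝒬 P ∈ˡ 𝒬 × first-below 𝒬 P ˢ⊑ cells P
  first-below-correct {X ∷ 𝒬} {P} any with em₀ {X ˢ⊑ cells P} | any
  ... | yes X⊑ | _         = here refl , X⊑
  ... | no  X⋢ | here X⊑   = contradiction X⊑ X⋢
  ... | no  _  | there any = let (∈𝒬 , ⊑P) = first-below-correct {𝒬} {P} any in there ∈𝒬 , ⊑P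

  first-below-cong : ∀ 𝒬 {P Q} → P ≅ Q → first-below 𝒬 P ≡ first-below 𝒬 Q
  first-below-cong []      P≅Q = refl
  first-below-cong (X ∷ 𝒬) {P} {Q} P≅Q with em₀ {X ˢ⊑ cells P} | em₀ {X ˢ⊑ cells Q}
  ... | yes _  | yes _  = refl
  ... | yes X⊑ | no  X⋢ = contradiction (ˢ⊑-trans {X} {P} {Q} X⊑ (≅⇒⊑ {P} {Q} P≅Q)) X⋢
  ... | no  X⋢ | yes X⊑ = contradiction (ˢ⊑-trans {X} {Q} {P} X⊑ (≅⇒⊑ {Q} {P} (≅-sym {P} {Q} P≅Q))) X⋢
  ... | no  _  | no  _  = first-below-cong 𝒬 {P} {Q} P≅Q

  -- For an unbounded set, each member is restricted to a shape of `𝒬` below it. The breaker defeats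
  -- this bounded restriction, hence not every one is a winner.
  loser : ∀ {𝒬 ℱ} → Defeated 𝒬 → All Grown 𝒬 → (∀ {P} → P ∈ ℱ → Any (_ˢ⊑ cells P) 𝒬) → ¬ Winner ℱ
  loser (π , symmetric , loopless , kills) _ below (inj₁ (_ , wins)) =
    Paving.breaker-wins π symmetric loopless kills below wins
  loser {𝒬} {ℱ} (π , symmetric , loopless , kills) grown below (inj₂ (_ , wins)) =
    Paving.breaker-wins π symmetric loopless {𝒮 = Restriction.members R} kills
      (λ where
        (T , t , refl) → lose (shape∈ t) (identity ,
          All.tabulate (subst (_∈ˡ shape T) (sym (apply-identity _)))))
      (wins R)
    where
    shape = first-below 𝒬
    shape∈ : ∀ {T} → T ∈ ℱ → shape T ∈ˡ 𝒬
    shape∈ {T} t = proj₁ (first-below-correct {𝒬} {T} (below t))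
    R : Restriction ℱ
    R = record
      { F        = λ {T} t → polyomino (shape T) (All.lookup grown (shape∈ t))
      ; finite   = λ {T} t → shape T , id
      ; ancestor = λ {T} t → map₂ (λ all → All.lookup all) (proj₂ (first-below-correct {𝒬} {T} (below t)))
      ; respects = λ {T} {T′} t t′ T≅T′ → identity , λ c → mk⇔
          (subst₂ _∈ˡ_ (sym (apply-identity c)) (first-below-cong 𝒬 {T} {T′} T≅T′))
          (subst₂ _∈ˡ_ (apply-identity c) (sym (first-below-cong 𝒬 {T} {T′} T≅T′)))
      }

  module _ (ℱ : PolyominoSet) where

    HasStraight : Set₁
    HasStraight = ∃[ P ] (P ∈ ℱ × P ⊑ S∞)

    -- Each member chooses a tetromino below it, and congruent members agree. Fewer than five
    -- classes leave one of the five tetrominoes unchosen.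
    omitted : FewerThan 5 ℱ → ¬ Has ℱ V → ¬ Has ℱ S₃ →
              ∃[ Q ] (Q ∈ˡ tetrominoes × (∀ {P} → P ∈ ℱ → Any (_ˢ⊑ cells P) (others Q)))
    omitted (Ps , ∣Ps∣<5 , covered) no-V no-S₃ =
      let (Q , Q∈ , Q∉) = escape _≟ˢ_ tetrominoes-unique (subst (ℕ._< 5) (sym (length-map choice Ps)) ∣Ps∣<5)
      in Q , Q∈ , λ {P} P∈ℱ →
        let (X∈ , X⊑P) = first-below-correct {tetrominoes} {P} (some P∈ℱ)
        in lose (∈-filter⁺ (λ X → ¬? (X ≟ˢ Q)) X∈ λ X≡Q → Q∉ (subst (_∈ˡ _) X≡Q (choice-∈ P∈ℱ))) X⊑P
      where
      choice = first-below tetrominoes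
      some : ∀ {P} → P ∈ ℱ → Any (_ˢ⊑ cells P) tetrominoes
      some {P} P∈ℱ = [ (λ P⊑V → contradiction (P , P∈ℱ , P⊑V) no-V)
                     , [ (λ P⊑S₃ → contradiction (P , P∈ℱ , P⊑S₃) no-S₃) , id ]′ ]′ (tetromino-below P)
      choice-∈ : ∀ {P} → P ∈ ℱ → choice P ∈ˡ map choice Ps
      choice-∈ {P} P∈ℱ = let (P′ , P′∈ , P≅P′) = find (covered P∈ℱ) in
        subst (_∈ˡ _) (sym (first-below-cong tetrominoes {P} {P′} P≅P′)) (∈-map⁺ choice P′∈)

    via : ∀ {X Q} → X ˢ⊑ cells Q → Has ℱ X → ∃[ P ] (P ∈ ℱ × P ⊑ Q)
    via {X} {Q} X⊑Q (P , P∈ℱ , P⊑X) = P , P∈ℱ , ⊑ˢ-ˢ⊑-trans {P} {X} {Q} P⊑X X⊑Q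

    Criterion : Set₁
    Criterion = HasStraight × (Has ℱ V ⊎ Has ℱ S₃ × Has ℱ O × Has ℱ S)

    Criterion⇒simpler : Criterion → ℱ ⪯ 𝒲
    Criterion⇒simpler (straight , _)             S∞∈𝒲        = straight
    Criterion⇒simpler (_ , inj₁ has-V)           T₂∈𝒲        = via {Q = T₂} V⊑T₂ has-V
    Criterion⇒simpler (_ , inj₁ has-V)           (C∈𝒲 n 2≤n) = via {Q = C n 2≤n} (V⊑C n 2≤n) has-V
    Criterion⇒simpler (_ , inj₁ has-V)           (Z∈𝒲 n 2≤n) = via {Q = Z n 2≤n} (V⊑Z n 2≤n) has-V
    Criterion⇒simpler (_ , inj₂ (has-S₃ , _))    T₂∈𝒲        = via {Q = T₂} (S₃⊑ 0 {T₂-cells} inj₁) has-S₃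
    Criterion⇒simpler (_ , inj₂ (_ , has-O , _)) (C∈𝒲 2 2≤2) = via {Q = C 2 2≤2} O⊑C₂ has-O
    Criterion⇒simpler (_ , inj₂ (_ , _ , has-S)) (Z∈𝒲 2 2≤2) = via {Q = Z 2 2≤2} S⊑Z₂ has-S
    Criterion⇒simpler (_ , inj₂ (has-S₃ , _)) (C∈𝒲 n@(suc (suc (suc m))) 2≤n) =
      via {Q = C n 2≤n} (S₃⊑ m {C-cells n} inj₁) has-S₃
    Criterion⇒simpler (_ , inj₂ (has-S₃ , _)) (Z∈𝒲 n@(suc (suc (suc m))) 2≤n) =
      via {Q = Z n 2≤n} (S₃⊑ m {Z-cells n} inj₁) has-S₃
    Criterion⇒simpler (_ , inj₂ _) (C∈𝒲 1 (s≤s ()))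
    Criterion⇒simpler (_ , inj₂ _) (Z∈𝒲 1 (s≤s ()))

    simpler⇒Criterion : FewerThan 5 ℱ → ℱ ⪯ 𝒲 → Criterion
    simpler⇒Criterion few ℱ⪯𝒲 = ℱ⪯𝒲 S∞∈𝒲 , rest
      where
      2≤2 : 2 ℕ.≤ 2
      2≤2 = ℕₚ.≤-refl
      2≤3 : 2 ℕ.≤ 3
      2≤3 = ℕₚ.n≤1+n 2
      within-shape : ∀ {Q X} → Q ∈ 𝒲 → (∀ {c} → c ∈ cells Q → c ∈ˡ X) → Has ℱ X
      within-shape {Q} {X} Q∈𝒲 Q⊆X = let (P , P∈ℱ , P⊑Q) = ℱ⪯𝒲 Q∈𝒲 in P , P∈ℱ , ⊆⇒⊑ˢ {P} {Q} Q⊆X P⊑Q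
      impossible : ∀ {Q Y} → (∀ {P} → P ∈ ℱ → Any (_ˢ⊑ cells P) (others Q)) →
                   All (λ X → ¬ X ˢ⊑ˢ Y) (others Q) → ¬ Has ℱ Y
      impossible below none (P , P∈ℱ , P⊑Y) = none-below {P = P} none P⊑Y (below P∈ℱ)
      none? : ∀ Q Y → Dec (All (λ X → ¬ X ˢ⊑ˢ Y) (others Q))
      none? Q Y = all? (λ X → ¬? (X ˢ⊑ˢ? Y)) (others Q)
      -- For each `Q` some polyomino of `𝒲` contains no tetromino other than `Q`, and neither does
      -- the member of `ℱ` below it.
      nothing-omitted : ∀ {Q} → Q ∈ˡ tetrominoes → ¬ (∀ {P} → P ∈ ℱ → Any (_ˢ⊑ cells P) (others Q))
      nothing-omitted (here refl) below =
        let (P , P∈ℱ , P⊑S∞) = ℱ⪯𝒲 S∞∈𝒲 in none-in-S∞ {P} P⊑S∞ (below P∈ℱ)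
      nothing-omitted (there (here refl)) below =
        impossible {T} {T} below (from-yes (none? T T)) (within-shape T₂∈𝒲 T₂⊆T)
      nothing-omitted (there (there (here refl))) below =
        impossible {O} {O} below (from-yes (none? O O)) (within-shape (C∈𝒲 2 2≤2) C₂⊆O)
      nothing-omitted (there (there (there (here refl)))) below =
        impossible {S} {S} below (from-yes (none? S S)) (within-shape (Z∈𝒲 2 2≤2) Z₂⊆S)
      nothing-omitted (there (there (there (there (here refl))))) below =
        impossible {L} {U} below (from-yes (none? L U)) (within-shape (C∈𝒲 3 2≤3) C₃⊆U)

      rest : Has ℱ V ⊎ Has ℱ S₃ × Has ℱ O × Has ℱ S
      rest with em {Has ℱ V} | em {Has ℱ S₃}
      ... | yes has-V | _          = inj₁ has-V
      -- `C 2` is the square and `Z 2` the skew tetromino.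
      ... | no  _     | yes has-S₃ = inj₂
        (has-S₃ , within-shape (C∈𝒲 2 2≤2) C₂⊆O , within-shape (Z∈𝒲 2 2≤2) Z₂⊆S)
      ... | no  no-V  | no  no-S₃  = let (Q , Q∈ , below) = omitted few no-V no-S₃ in
        ⊥-elim (nothing-omitted Q∈ (λ {P} → below {P}))

    Winner⇒Criterion : FewerThan 5 ℱ → NoTwoEndedLine ℱ → Winner ℱ → Criterion
    Winner⇒Criterion few no-line winner = straight-member , rest
      where
      lost : ∀ 𝒬 → Defeated 𝒬 → All Grown 𝒬 → ¬ (∀ {P} → P ∈ ℱ → Any (_ˢ⊑ cells P) 𝒬)
      lost 𝒬 defeated grown below = loser {𝒬} defeated grown below winner

      straight-member : HasStraight
      straight-member with em {∃[ P ] (P ∈ ℱ × ¬ V ˢ⊑ cells P)}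
      -- Every member contains a corner, and the breaker wins on the columns.
      ... | no ∄P = ⊥-elim
        (lost 𝒬 (lines , from-yes (defeats? lines 𝒬)) (from-yes (all? grown? 𝒬)) λ {P} P∈ℱ →
          here (decidable-stable em₀ λ V⋢P → ∄P (P , P∈ℱ , V⋢P)))
        where 𝒬 = V ∷ []
      ... | yes (P , P∈ℱ , V⋢P) with straight P V⋢P
      ...   | inj₁ P⊑S∞ = P , P∈ℱ , P⊑S∞
      ...   | inj₂ P≅line = contradiction P≅line (no-line P∈ℱ)

      rest : Has ℱ V ⊎ Has ℱ S₃ × Has ℱ O × Has ℱ S
      rest with em {Has ℱ V} | em {Has ℱ S₃}
      ... | yes has-V | _         = inj₁ has-V
      ... | no  no-V  | no  no-S₃ = let (Q , Q∈ , below) = omitted few no-V no-S₃ in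
        ⊥-elim (lost (others Q) (others-defeated Q∈) (others-grown Q∈) (λ {P} → below {P}))
      ... | no  no-V  | yes has-S₃ = inj₂
        (has-S₃ , decidable-stable em S₃-S-lost , decidable-stable em S₃-O-W-lost)
        where
        V⋣ : ∀ {P} → P ∈ ℱ → ¬ P ⊑ˢ V
        V⋣ {P} P∈ℱ P⊑V = no-V (P , P∈ℱ , P⊑V)
        -- With no member inside the square, every member contains `S₃` or `S`, and `snakes` has an
        -- edge in every copy of these.
        S₃-S-lost : ¬ ¬ Has ℱ O
        S₃-S-lost no-O = lost 𝒬 (snakes , from-yes (defeats? snakes 𝒬)) (from-yes (all? grown? 𝒬)) λ {P} P∈ℱ →
          without-O P (V⋣ P∈ℱ) λ P⊑O → no-O (P , P∈ℱ , P⊑O)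
          where 𝒬 = S₃ ∷ S ∷ []
        -- With no member inside the skew tetromino, every member contains `S₃`, `O` or `W`, and
        -- `bricks` has an edge in every copy of these.
        S₃-O-W-lost : ¬ ¬ Has ℱ S
        S₃-O-W-lost no-S = lost 𝒬 (bricks , from-yes (defeats? bricks 𝒬)) (from-yes (all? grown? 𝒬)) λ {P} P∈ℱ →
          without-S P (V⋣ P∈ℱ) λ P⊑S → no-S (P , P∈ℱ , P⊑S)
          where 𝒬 = S₃ ∷ O ∷ W ∷ []

    Criterion⇒Winner : Criterion → Winner ℱ
    Criterion⇒Winner ((P , P∈ℱ , P⊑S∞) , rest) with em {Unbounded ℱ}
    ... | no bounded = inj₁ (bounded ,
      [ (λ has-V → V-and-finite-line-win has-V (P , P∈ℱ , P⊑S∞ , P-finite))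
      , (λ (has-S₃ , has-O , has-S) → S₃-O-S-win ℱ has-S₃ has-O has-S) ]′ rest)
      where
      P-finite : Finite P
      P-finite = decidable-stable em₀ λ infinite → bounded (P , P∈ℱ , infinite)
    ... | yes unbounded = inj₂ (unbounded , restriction-wins)
      where
      module _ (R : Restriction ℱ) where
        open Restriction R
        -- An ancestor of a polyomino inside `X` also lies inside `X`; in this way the criterion
        -- passes to every bounded restriction.
        restrict : ∀ {X} → Has ℱ X → Has members X
        restrict {X} (Q , q , Q⊑X) = F q , (Q , q , refl) , ⊑-⊑ˢ-trans {F q} {Q} {X} (ancestor q) Q⊑X
        straight-restriction : ∃[ Q ] (Q ∈ members × Q ⊑ S∞ × Finite Q)
        straight-restriction = F P∈ℱ , (P , P∈ℱ , refl) ,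
          ⊑-trans {F P∈ℱ} {P} {S∞} (ancestor P∈ℱ) P⊑S∞ , finite P∈ℱ
        restriction-wins : MakerWins members
        restriction-wins =
          [ (λ has-V → V-and-finite-line-win (restrict has-V) straight-restriction)
          , (λ (has-S₃ , has-O , has-S) →
              S₃-O-S-win members (restrict has-S₃) (restrict has-O) (restrict has-S)) ]′ rest

theorem6p9 : ExcludedMiddle (lsuc 0ℓ) →
    (ℱ : PolyominoSet) → Team ℱ → FewerThan 5 ℱ → NoTwoEndedLine ℱ →
    Winner ℱ ⇔ ℱ ⪯ 𝒲
theorem6p9 em ℱ _ few no-line = mk⇔
  (Criterion⇒simpler ℱ ∘ Winner⇒Criterion ℱ few no-line)
  (Criterion⇒Winner ℱ ∘ simpler⇒Criterion ℱ few)
  where open Characterisation em
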